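{- Let $n\ge 1$ and let $(h_{ij})_{0\le j\le i\le n-1}$ be the $h$-triangle of $\Delta_{\mathrm{Dyck}_n}$. For $0\le j\le i\le n-1$, \[ h_{ij}=\Big|\big\{\,w\in\mathrm{Dyck}_n^{\max} : |V(w)|=i\text{ and }\mathrm{suc}(w)=i-j\,\big\}\Big| . \]
   Context: A Dyck path of semilength $n$ is a word $w=w_1\cdots w_{2n}$ in $\{U,D\}$ with equally many $U$'s and $D$'s such that every prefix contains at least as many $U$'s as $D$'s; $\mathrm{Dyck}_n$ is the set of these. A valley of $w$ is an index $i$ with $w_i=D$, $w_{i+1}=U$, identified with its position $(i,y)$, where $y$ is the number of $U$'s minus the number of $D$'s in $w_1\cdots w_i$. $V(w)$ is the set of valley positions of $w$, and $\Delta_{\mathrm{Dyck}_n}=\{V(w):w\in\mathrm{Dyck}_n\}$, which is a simplicial complex. $\mathrm{Dyck}_n^{\max}$ is the set of $w\in\mathrm{Dyck}_n$ for which $V(w)$ is a maximal face of $\Delta_{\mathrm{Dyck}_n}$; equivalently, those $w$ having no factor (consecutive subword) $UUDD$. A valley $(x,y)\in V(w)$ is successive if $(x-2,y)\in V(w)\cup\{(0,0)\}$, and $\mathrm{suc}(w)$ is the number of successive valleys of $w$. For a simplicial complex $\Delta$, the degree of a face $\sigma$ is $\deg(\sigma)=\max\{|\tau| : \tau\in\Delta,\ \sigma\subseteq\tau\}$, and $f_{ij}$ is the number of faces $\sigma$ with $|\sigma|=j$ and $\deg(\sigma)=i$. The $h$-triangle $(h_{ij})_{0\le j\le i}$ is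 defined by $\sum_{0\le j\le i}h_{ij}x^iy^{i-j}=\sum_{0\le j\le i}f_{ij}x^i(y-1)^{i-j}$. -}

module Defs where

open import Data.Integer as ℤ using (ℤ; +_; _⊖_)
open import Data.List using
  (List; []; _∷_; length; map; filter; foldr; upTo; take; drop; head; last;
   inits; deduplicate; cartesianProductWith)
open import Data.List.Extrema.Nat using (max)
open import Data.List.Properties using (≡-dec)
open import Data.List.Relation.Unary.All using (All; all?)
open import Data.List.Relation.Unary.Any using (Any; any?)
import Data.List.Relation.Binary.Subset.DecPropositional as DecSubset
open import Data.Maybe using (just)
import Data.Maybe.Properties as Maybe
open import Data.Nat as ℕ using (ℕ; zero; suc; _+_; _∸_; _≤_)
open import Data.Product using (_×_; _,_)
import Data.Product.Properties as Product
open import Relation.Binary.Definitions using (DecidableEquality)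
open import Relation.Binary.PropositionalEquality using (_≡_; refl)
open import Relation.Nullary using (Dec; yes; no)
open import Relation.Nullary.Decidable using (_×-dec_; _→-dec_)

-- Formal power series in x and y over ℤ: p a b is the coefficient of xᵃyᵇ.
-- Polynomials are the finitely supported ones, and an identity between
-- polynomials in ℤ[x,y] is the same as an identity in ℤ⟦x,y⟧.

ℤ⟦x,y⟧ : Set
ℤ⟦x,y⟧ = ℕ → ℕ → ℤ

infix  4 _≈_
infixl 6 _⊕_
infixl 7 _⊗_
infixr 8 _^^_

_≈_ : ℤ⟦x,y⟧ → ℤ⟦x,y⟧ → Set
p ≈ q = ∀ a b → p a b ≡ q a b

const : ℤ → ℤ⟦x,y⟧
const c zero zero = c
const c _    _    = + 0

𝕩 : ℤ⟦x,y⟧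
𝕩 1 0 = + 1
𝕩 _ _ = + 0

𝕪 : ℤ⟦x,y⟧
𝕪 0 1 = + 1
𝕪 _ _ = + 0

_⊕_ : ℤ⟦x,y⟧ → ℤ⟦x,y⟧ → ℤ⟦x,y⟧
(p ⊕ q) a b = p a b ℤ.+ q a b

sum≤ : ℕ → (ℕ → ℤ) → ℤ
sum≤ n g = foldr ℤ._+_ (+ 0) (map g (upTo (suc n)))

_⊗_ : ℤ⟦x,y⟧ → ℤ⟦x,y⟧ → ℤ⟦x,y⟧
(p ⊗ q) a b = sum≤ a λ k → sum≤ b λ l → p k l ℤ.* q (a ∸ k) (b ∸ l)

_^^_ : ℤ⟦x,y⟧ → ℕ → ℤ⟦x,y⟧
p ^^ zero  = const (+ 1)
p ^^ suc k = p ⊗ (p ^^ k)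

Σ≤ : ℕ → (ℕ → ℤ⟦x,y⟧) → ℤ⟦x,y⟧
Σ≤ n g = foldr _⊕_ (const (+ 0)) (map g (upTo (suc n)))

-- A finite set is represented by a list of its elements without repetition,
-- listed in an order determined by the set (here: by increasing index), so
-- that length is cardinality and _≡_ on lists is equality of sets.
-- A finite simplicial complex is the repetition-free list Δ of its faces.

module Complex {A : Set} (_≟_ : DecidableEquality A) (Δ : List (List A)) where

  open DecSubset _≟_ public using (_⊆_; _⊆?_)

  deg : List A → ℕ
  deg σ = max 0 (map length (filter (σ ⊆?_) Δ))

  Maximal : List A → Set
  Maximal σ = All (λ τ → σ ⊆ τ → τ ⊆ σ) Δ

  maximal? : ∀ σ → Dec (Maximal σ)
  maximal? σ = all? (λ τ → (σ ⊆? τ) →-dec (τ ⊆? σ)) Δ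

  f : ℕ → ℕ → ℕ
  f i j = length (filter (λ σ → (length σ ℕ.≟ j) ×-dec (deg σ ℕ.≟ i)) Δ)

  -- The largest cardinality of a face, hence the largest degree.
  rank : ℕ
  rank = max 0 (map length Δ)

  -- Only the entries h i j with j ≤ i ≤ rank belong to the h-triangle.
  IsHTriangle : (ℕ → ℕ → ℤ) → Set
  IsHTriangle h =
      Σ≤ rank (λ i → Σ≤ i λ j →
        const (h i j) ⊗ 𝕩 ^^ i ⊗ 𝕪 ^^ (i ∸ j))
    ≈ Σ≤ rank (λ i → Σ≤ i λ j →
        const (+ f i j) ⊗ 𝕩 ^^ i ⊗ (𝕪 ⊕ const (ℤ.- + 1)) ^^ (i ∸ j))

data Step : Set where
  U D : Step

infix 4 _≟ˢ_ _≟ᵖ_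

_≟ˢ_ : DecidableEquality Step
U ≟ˢ U = yes refl
U ≟ˢ D = no λ ()
D ≟ˢ U = no λ ()
D ≟ˢ D = yes refl

Word : Set
Word = List Step

words : ℕ → List Word
words zero    = [] ∷ []
words (suc k) = cartesianProductWith _∷_ (U ∷ D ∷ []) (words k)

# : Step → Word → ℕ
# s w = length (filter (s ≟ˢ_) w)

IsDyck : Word → Set
IsDyck w = # U w ≡ # D w × All (λ p → # D p ≤ # U p) (inits w)

isDyck? : ∀ w → Dec (IsDyck w)
isDyck? w = (# U w ℕ.≟ # D w) ×-dec all? (λ p → # D p ℕ.≤? # U p) (inits w)

Dyck : ℕ → List Word
Dyck n = filter isDyck? (words (2 ℕ.* n))

Position : Set
Position = ℕ × ℤ

_≟ᵖ_ : DecidableEquality Position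
_≟ᵖ_ = Product.≡-dec ℕ._≟_ ℤ._≟_

-- wᵢ = D and wᵢ₊₁ = U, with letters numbered from 1.
IsValley : Word → ℕ → Set
IsValley w i = last (take i w) ≡ just D × head (drop i w) ≡ just U

isValley? : ∀ w i → Dec (IsValley w i)
isValley? w i =
  Maybe.≡-dec _≟ˢ_ (last (take i w)) (just D) ×-dec
  Maybe.≡-dec _≟ˢ_ (head (drop i w)) (just U)

height : Word → ℤ
height w = # U w ⊖ # D w

V : Word → List Position
V w = map (λ i → i , height (take i w)) (filter (isValley? w) (upTo (length w)))

ΔDyck : ℕ → List (List Position)
ΔDyck n = deduplicate (≡-dec _≟ᵖ_) (map V (Dyck n))

module DyckComplex (n : ℕ) = Complex _≟ᵖ_ (ΔDyck n)

Dyckᵐᵃˣ : ℕ → List Word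
Dyckᵐᵃˣ n = filter (λ w → DyckComplex.maximal? n (V w)) (Dyck n)

-- Writing x = 2 + x′ makes x - 2 an honest subtraction.
Successive : Word → Position → Set
Successive w (x , y) =
  Any (λ (x′ , y′) → x ≡ 2 + x′ × y ≡ y′) ((0 , + 0) ∷ V w)

successive? : ∀ w v → Dec (Successive w v)
successive? w (x , y) =
  any? (λ (x′ , y′) → (x ℕ.≟ 2 + x′) ×-dec (y ℤ.≟ y′)) ((0 , + 0) ∷ V w)

sucᵛ : Word → ℕ
sucᵛ w = length (filter (successive? w) (V w))

{-# OPTIONS --safe #-}
module Submission where

-- Write a Dyck path as a product of blocks UᵖDᑫ. In the coordinates (#U , #D) the
-- faces are the chains of points (a , b) with 1 ≤ b ≤ a ≤ n - 1 that increase strictly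
-- in both coordinates, so that deg (V w) + 1 is the sum of p ⊓ q over the blocks of
-- w. Hence w is maximal when p ⊓ q = 1 for all blocks, and suc w counts the blocks UD
-- other than the last block. Replacing a block with p , q ≥ 2 by UD and Uᵖ⁻¹Dᑫ⁻¹
-- shows that Σ x^(deg + 1) (y - 1)^(deg - |V|) over all Dyck paths satisfies the same
-- recursion as Σ x^(|V| + 1) y^suc over the maximal ones.

open import Data.Bool using (Bool; true; false; if_then_else_; _∧_)
open import Data.Bool.Properties using (∧-zeroʳ)
open import Data.Integer as ℤ using (ℤ; +_; _⊖_)
import Data.Integer.Properties as ℤₚ
open import Data.Integer.Tactic.RingSolver using (solve-∀)
open import Data.List using
  (List; []; _∷_; _++_; applyUpTo; deduplicate; drop; filter; foldr; head; inits;
   last; length; map; take; upTo)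
open import Data.List.Extrema.Nat using (max≤v⁺; v≤max⁺)
open import Data.List.Membership.Propositional using (_∈_; find; lose)
open import Data.List.Membership.Propositional.Properties using
  (∈-map⁺; ∈-map⁻; ∈-filter⁺; ∈-filter⁻; ∈-cartesianProductWith⁺; ∈-cartesianProductWith⁻)
open import Data.List.Properties using
  (filter-all; length-map; map-applyUpTo; map-injective; map-upTo; ++-identityʳ; ∷-injectiveʳ)
open import Data.List.Relation.Binary.Subset.Propositional using (_⊆_)
open import Data.List.Relation.Unary.All as All using (All; []; _∷_)
import Data.List.Relation.Unary.All.Properties as Allₚ
open import Data.List.Relation.Unary.AllPairs using ([]; _∷_)
open import Data.List.Relation.Unary.Any using (Any; here; there)
open import Data.List.Relation.Unary.Unique.Propositional using (Unique)
import Data.List.Relation.Unary.Unique.Propositional.Properties as Uniqueₚ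
open import Data.Maybe using (just)
import Data.Maybe.Properties as Maybe
open import Data.Nat as ℕ using
  (ℕ; zero; suc; pred; _+_; _∸_; _⊓_; _≤_; _<_; _≟_; _≡ᵇ_; z≤n; s≤s)
import Data.Nat.Properties as ℕₚ
open import Data.Nat.Solver using (module +-*-Solver)
open import Data.Product using (_×_; _,_; proj₁; proj₂; ∃-syntax)
import Data.Product.Properties as Product
open import Data.Sum using (_⊎_; inj₁; inj₂)
open import Function using (_∘_; id)
open import Function.Bundles using (mk⇔)
open import Relation.Binary.Definitions using (DecidableEquality)
open import Relation.Binary.PropositionalEquality using
  (_≡_; _≢_; refl; sym; trans; cong; cong₂; subst; module ≡-Reasoning)
open import Relation.Nullary using (Dec; yes; no; does; ¬_; ¬?; contradiction)
open import Relation.Nullary.Decidable using (_×-dec_; does-⇔)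
open import Relation.Unary using (Decidable)
open import Defs

-- The number p ⊓ q of a block is known only when its D-run ends, so the statistics are computed
-- letter by letter: inside a D-run it suffices to remember p ∸ q, and the factor y of a block UD is
-- charged to the U that follows it, which is how the last block escapes. There is no comparison
-- path by path. In `F` the blocks with p , q ≥ 2 yield x(y - 1) times the sum for the block
-- shortened by a factor UD. In `H` such blocks are absent, but a UD followed by another block
-- weighs xy instead of x, a surplus of x(y - 1) times the sum over everything that starts with that
-- next block. The two extra terms agree by induction on the length. Polynomial arithmetic is
-- avoided by pairing both sums with an arbitrary functional ψ on monomials: multiplying by x or by
-- y - 1 becomes a change of ψ, so the induction has to run over all ψ at once. At the end ψ reads
-- off a single coefficient. The degree formula has two halves: a bound on the chains containing a
-- given one, and a chain that attains it, built from diagonal steps because these never leave the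
-- region b ≤ a.

-- The state of a path read up to some letter: up p inside the U-run of a block
-- UᵖDᑫ, peak right after a block UD, and otherwise down (p ∸ q) inside the D-run.
data State : Set where
  up down : ℕ → State
  peak    : State

next : State → Step → State
next (up p)             U = up (suc p)
next (up 0)             D = down 0
next (up 1)             D = peak
next (up (suc (suc p))) D = down (suc p)
next (down r)           U = up 1
next (down r)           D = down (pred r)
next peak               U = up 1
next peak               D = down 0

-- Over the blocks UᵖDᑫ, minSum adds up p ⊓ q, excess adds up p ⊓ q ∸ 1, and
-- singles counts the blocks UD that are not the last one.

minSum : State → Word → ℕ
minSum s              []      = 0
minSum s              (U ∷ w) = minSum (next s U) w
minSum (up 0)         (D ∷ w) = minSum (down 0) w
minSum (up (suc p))   (D ∷ w) = suc (minSum (next (up (suc p)) D) w)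
minSum (down 0)       (D ∷ w) = minSum (down 0) w
minSum (down (suc r)) (D ∷ w) = suc (minSum (down r) w)
minSum peak           (D ∷ w) = minSum (down 0) w

excess : State → Word → ℕ
excess s              []      = 0
excess s              (U ∷ w) = excess (next s U) w
excess (up p)         (D ∷ w) = excess (next (up p) D) w
excess (down 0)       (D ∷ w) = excess (down 0) w
excess (down (suc r)) (D ∷ w) = suc (excess (down r) w)
excess peak           (D ∷ w) = excess (down 0) w

singles : State → Word → ℕ
singles s        []      = 0
singles (up p)   (U ∷ w) = singles (up (suc p)) w
singles (down r) (U ∷ w) = singles (up 1) w
singles peak     (U ∷ w) = suc (singles (up 1) w)
singles s        (D ∷ w) = singles (next s D) w

valid : ℕ → Word → Bool
valid zero    []      = true
valid (suc h) []      = false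
valid h       (U ∷ w) = valid (suc h) w
valid zero    (D ∷ w) = false
valid (suc h) (D ∷ w) = valid h w

-- Weighted sums over words and the recursion shared by `F` and `H`

+-congˡ : ∀ a {b c : ℤ} → b ≡ c → a ℤ.+ b ≡ a ℤ.+ c
+-congˡ a refl = refl

∑ʷ : ℕ → (Word → ℤ) → ℤ
∑ʷ zero    φ = φ []
∑ʷ (suc n) φ = ∑ʷ n (λ w → φ (U ∷ w)) ℤ.+ ∑ʷ n (λ w → φ (D ∷ w))

∑ʷ-cong : ∀ n {φ ψ : Word → ℤ} → (∀ w → φ w ≡ ψ w) → ∑ʷ n φ ≡ ∑ʷ n ψ
∑ʷ-cong zero    e = e []
∑ʷ-cong (suc n) e = cong₂ ℤ._+_ (∑ʷ-cong n (λ w → e (U ∷ w))) (∑ʷ-cong n (λ w → e (D ∷ w)))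

∑ʷ-zero : ∀ n → ∑ʷ n (λ _ → + 0) ≡ + 0
∑ʷ-zero zero    = refl
∑ʷ-zero (suc n) = cong₂ ℤ._+_ (∑ʷ-zero n) (∑ʷ-zero n)

∑ʷ-sub : ∀ n (φ ψ : Word → ℤ) → ∑ʷ n (λ w → φ w ℤ.- ψ w) ≡ ∑ʷ n φ ℤ.- ∑ʷ n ψ
∑ʷ-sub zero    φ ψ = refl
∑ʷ-sub (suc n) φ ψ =
  trans (cong₂ ℤ._+_ (∑ʷ-sub n (λ w → φ (U ∷ w)) (λ w → ψ (U ∷ w)))
                     (∑ʷ-sub n (λ w → φ (D ∷ w)) (λ w → ψ (D ∷ w))))
        (lem (∑ʷ n (λ w → φ (U ∷ w))) _ _ _)
  where
  lem : ∀ a b c e → (a ℤ.- b) ℤ.+ (c ℤ.- e) ≡ (a ℤ.+ c) ℤ.- (b ℤ.+ e)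
  lem = solve-∀

-- A linear functional on ℤ[x,y], given by its values ψ a s on the monomials xᵃyˢ.
Functional : Set
Functional = ℕ → ℕ → ℤ

-- eval[y-1]^ e f and eval0^ e (f s) are the values at (y - 1)ᵉ and at 0ᵉyˢ of the
-- functional on ℤ[y] sending yˢ to f s.

eval[y-1]^ : ℕ → (ℕ → ℤ) → ℤ
eval[y-1]^ zero    f = f 0
eval[y-1]^ (suc e) f = eval[y-1]^ e (λ s → f (suc s) ℤ.- f s)

eval0^ : ℕ → ℤ → ℤ
eval0^ zero    c = c
eval0^ (suc _) c = + 0

_when_ : ℤ → Bool → ℤ
c when b = if b then c else + 0

-- ψ applied to the generating functions Σ x^minSum (y - 1)^excess over all
-- completions, and Σ x^minSum y^singles over those without excess.
F H : Functional → State → ℕ → ℕ → ℤ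
F ψ s h n = ∑ʷ n λ w → eval[y-1]^ (excess s w) (ψ (minSum s w)) when valid h w
H ψ s h n = ∑ʷ n λ w → eval0^ (excess s w) (ψ (minSum s w) (singles s w)) when valid h w

-- The functionals precomposed with multiplication by x, by y, and by x(y - 1).
X Y Z : Functional → Functional
X ψ a s = ψ (suc a) s
Y ψ a s = ψ a (suc s)
Z ψ a s = X (Y ψ) a s ℤ.- X ψ a s

when-zero : ∀ b → (+ 0) when b ≡ + 0
when-zero true  = refl
when-zero false = refl

H-sub : ∀ φ ψ s h n → H (λ a k → φ a k ℤ.- ψ a k) s h n ≡ H φ s h n ℤ.- H ψ s h n
H-sub φ ψ s h n =
  trans (∑ʷ-cong n λ w → lem (excess s w) (valid h w) (φ (minSum s w) (singles s w)) (ψ (minSum s w) (singles s w)))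
        (∑ʷ-sub n _ _)
  where
  lem : ∀ e b c c′ → eval0^ e (c ℤ.- c′) when b ≡ eval0^ e c when b ℤ.- eval0^ e c′ when b
  lem zero    true  c c′ = refl
  lem (suc e) true  c c′ = refl
  lem e       false c c′ = refl

minSum-peak : ∀ w → minSum peak w ≡ minSum (down 0) w
minSum-peak []      = refl
minSum-peak (U ∷ w) = refl
minSum-peak (D ∷ w) = refl

excess-peak : ∀ w → excess peak w ≡ excess (down 0) w
excess-peak []      = refl
excess-peak (U ∷ w) = refl
excess-peak (D ∷ w) = refl

singles-down : ∀ r r′ w → singles (down r) w ≡ singles (down r′) w
singles-down r r′ []      = refl
singles-down r r′ (U ∷ w) = refl
singles-down r r′ (D ∷ w) = singles-down (pred r) (pred r′) w

-- The states `peak` and `down 0` differ only in what `singles` records, and `F` does not look at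
-- it.
F-peak : ∀ ψ h n → F ψ peak h n ≡ F ψ (down 0) h n
F-peak ψ h n = ∑ʷ-cong n λ w →
  cong₂ (λ e a → eval[y-1]^ e (ψ a) when valid h w) (excess-peak w) (minSum-peak w)

-- A block UD counts y instead of 1 as soon as another block follows it.
H-peak : ∀ ψ h n → H ψ peak h (suc n) ≡
  H ψ (down 0) h (suc n) ℤ.+ (H (Y ψ) (up 1) (suc h) n ℤ.- H ψ (up 1) (suc h) n)
H-peak ψ zero n = lem (H (Y ψ) (up 1) 1 n) (H ψ (up 1) 1 n) (∑ʷ n λ _ → + 0)
  where
  lem : ∀ a b c → a ℤ.+ c ≡ (b ℤ.+ c) ℤ.+ (a ℤ.- b)
  lem = solve-∀
H-peak ψ (suc h) n =
  lem (H (Y ψ) (up 1) (suc (suc h)) n) (H ψ (up 1) (suc (suc h)) n) (H ψ (down 0) h n)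
  where
  lem : ∀ a b c → a ℤ.+ c ≡ (b ℤ.+ c) ℤ.+ (a ℤ.- b)
  lem = solve-∀

F-up-D : ∀ ψ p h n → F ψ (up (suc p)) (suc h) (suc n) ≡
  F ψ (up (suc (suc p))) (suc (suc h)) n ℤ.+ F (X ψ) (down p) h n
F-up-D ψ zero    h n = +-congˡ (F ψ (up 2) (suc (suc h)) n) (F-peak (X ψ) h n)
F-up-D ψ (suc p) h n = refl

-- A further D in this run would make the excess positive, so `eval0^` annihilates that branch.
H-down-D : ∀ ψ r h n →
  H ψ (down (suc r)) (suc h) (suc n) ≡ H ψ (up 1) (suc (suc h)) n
H-down-D ψ r h n = trans (+-congˡ (H ψ (up 1) (suc (suc h)) n)
  (trans (∑ʷ-cong n λ w → when-zero (valid h w)) (∑ʷ-zero n))) (ℤₚ.+-identityʳ _)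

-- Cutting a factor UD out of a block UᵖDᑫ with p , q ≥ 2 costs exactly x(y - 1) in
-- F, while in H this term is the difference between y and 1 as weights of a block
-- UD that is not the last one. So F and H satisfy the same recursion.

F≡H-up : ∀ n ψ h → F ψ (up 1) (suc h) n ≡ H ψ (up 1) (suc h) n
F≡H-down : ∀ n ψ h → F ψ (down 0) h n ≡ H ψ (down 0) h n
F-split-down : ∀ n ψ r h → F ψ (down (suc r)) (suc h) (suc n) ≡
  H ψ (down (suc r)) (suc h) (suc n) ℤ.+ F (Z ψ) (down r) h n
F-split-up : ∀ n ψ p h → F ψ (up (suc (suc p))) (suc (suc h)) (suc n) ≡
  H ψ (up (suc (suc p))) (suc (suc h)) (suc n) ℤ.+ F (Z ψ) (up (suc p)) (suc h) n

F≡H-up zero    ψ h = refl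
F≡H-up (suc zero) ψ zero    = refl
F≡H-up (suc zero) ψ (suc h) = refl
-- The extra term supplied by `F-split-up` in the U branch is exactly the surplus of `peak` over
-- `down 0` that `H-peak` needs in the D branch.
F≡H-up (suc (suc n)) ψ h = trans
  (cong₂ ℤ._+_
    (trans (F-split-up n ψ 0 h) (+-congˡ (H ψ (up 2) (suc (suc h)) (suc n))
       (trans (F≡H-up n (Z ψ) h) (H-sub (X (Y ψ)) (X ψ) (up 1) (suc h) n))))
    (trans (F-peak (X ψ) h (suc n)) (F≡H-down (suc n) (X ψ) h)))
  (trans (lem (H ψ (up 2) (suc (suc h)) (suc n)) _ _)
    (+-congˡ (H ψ (up 2) (suc (suc h)) (suc n)) (sym (H-peak (X ψ) h n))))
  where
  lem : ∀ a b c → (a ℤ.+ b) ℤ.+ c ≡ a ℤ.+ (c ℤ.+ b)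
  lem = solve-∀

F≡H-down zero    ψ zero    = refl
F≡H-down zero    ψ (suc h) = refl
F≡H-down (suc n) ψ zero    = cong (ℤ._+ ∑ʷ n (λ _ → + 0)) (F≡H-up n ψ 0)
F≡H-down (suc n) ψ (suc h) = cong₂ ℤ._+_ (F≡H-up n ψ (suc h)) (F≡H-down n ψ h)

-- In the D branch `minSum` and `excess` both grow by one, which turns ψ into `Z ψ` by computation;
-- this is the extra term, and `H` has nothing there.
F-split-down n ψ r h = cong₂ ℤ._+_
  (trans (F≡H-up n ψ (suc h)) (sym (H-down-D ψ r h n))) refl

F-split-up zero ψ zero    h = refl
F-split-up zero ψ (suc p) h = refl
-- The cut is postponed past the next letter. If that is the first D, its factor x commutes with x(y
-- - 1), and `F-up-D` reassembles the shortened block.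
F-split-up (suc n) ψ p h = trans
  (cong₂ ℤ._+_ (F-split-up n ψ (suc p) (suc h)) (F-split-down n (X ψ) p h))
  (trans (lem (H ψ (up (suc (suc (suc p)))) (suc (suc (suc h))) (suc n)) _ (H (X ψ) (down (suc p)) (suc h) (suc n)) _)
    (+-congˡ (H ψ (up (suc (suc p))) (suc (suc h)) (suc (suc n))) (sym (F-up-D (Z ψ) p h n))))
  where
  lem : ∀ a b c e → (a ℤ.+ b) ℤ.+ (c ℤ.+ e) ≡ (a ℤ.+ c) ℤ.+ (b ℤ.+ e)
  lem = solve-∀

-- Valley positions as lattice points

valid-U : ∀ h w → valid h (U ∷ w) ≡ valid (suc h) w
valid-U zero    w = refl
valid-U (suc h) w = refl

-- The point reached after a steps U and b steps D.
Point : Set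
Point = ℕ × ℕ

-- The valleys of w when w starts at (a , b) just after the letter s.
valleysFrom : Step → ℕ → ℕ → Word → List Point
valleysFrom s a b []      = []
valleysFrom U a b (U ∷ w) = valleysFrom U (suc a) b w
valleysFrom D a b (U ∷ w) = (a , b) ∷ valleysFrom U (suc a) b w
valleysFrom s a b (D ∷ w) = valleysFrom D a (suc b) w

valleys : Word → List Point
valleys w = valleysFrom U 0 0 w

position : Point → Position
position (a , b) = a + b , a ⊖ b

-- Test and value are functions of the index, so passing to the tail of a word is composition with
-- `suc`. This turns the index-based `V` into a recursion along the word.
select : ∀ {A : Set} → (ℕ → Bool) → (ℕ → A) → ℕ → List A
select β g zero    = []
select β g (suc n) =
  if β 0 then g 0 ∷ select (β ∘ suc) (g ∘ suc) n else select (β ∘ suc) (g ∘ suc) n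

map-filter-applyUpTo : ∀ {A : Set} {P : ℕ → Set} (P? : Decidable P) (g : ℕ → A) f n →
  map g (filter P? (applyUpTo f n)) ≡ select (does ∘ P? ∘ f) (g ∘ f) n
map-filter-applyUpTo P? g f zero    = refl
map-filter-applyUpTo P? g f (suc n) with does (P? (f 0))
... | true  = cong (g (f 0) ∷_) (map-filter-applyUpTo P? g (f ∘ suc) n)
... | false = map-filter-applyUpTo P? g (f ∘ suc) n

select-cong : ∀ {A : Set} (β : ℕ → Bool) {g g′ : ℕ → A} n → (∀ i → g i ≡ g′ i) → select β g n ≡ select β g′ n
select-cong β zero    e = refl
select-cong β (suc n) e with β 0
... | true  = cong₂ _∷_ (e 0) (select-cong (β ∘ suc) n (e ∘ suc))
... | false = select-cong (β ∘ suc) n (e ∘ suc)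

-- Of the letters already read, only the last one, `s`, can still decide whether there is a valley.
valley-after : Step → Word → ℕ → Bool
valley-after s w i = does (Maybe.≡-dec _≟ˢ_ (last (s ∷ take i w)) (just D) ×-dec
                           Maybe.≡-dec _≟ˢ_ (head (drop i w)) (just U))

position-after : ℕ → ℕ → Word → ℕ → Position
position-after a b w i = a + b + i , (a + # U (take i w)) ⊖ (b + # D (take i w))

position-after-U : ∀ a b w i → position-after a b (U ∷ w) (suc i) ≡ position-after (suc a) b w i
position-after-U a b w i =
  cong₂ _,_ (ℕₚ.+-suc (a + b) i) (cong (_⊖ (b + # D (take i w))) (ℕₚ.+-suc a _))

position-after-D : ∀ a b w i → position-after a b (D ∷ w) (suc i) ≡ position-after a (suc b) w i
position-after-D a b w i = cong₂ _,_
  (trans (ℕₚ.+-suc (a + b) i) (cong (_+ i) (sym (ℕₚ.+-suc a b)))) (cong ((a + # U (take i w)) ⊖_) (ℕₚ.+-suc b _))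

position-after-0 : ∀ a b w → position-after a b w 0 ≡ position (a , b)
position-after-0 a b w =
  cong₂ _,_ (ℕₚ.+-identityʳ (a + b)) (cong₂ _⊖_ (ℕₚ.+-identityʳ a) (ℕₚ.+-identityʳ b))

select-valleys : ∀ s a b w → select (valley-after s w) (position-after a b w) (length w) ≡
  map position (valleysFrom s a b w)
select-valleys s a b []      = refl
select-valleys U a b (U ∷ w) =
  trans (select-cong (valley-after U w) (length w) (position-after-U a b w)) (select-valleys U (suc a) b w)
select-valleys D a b (U ∷ w) = cong₂ _∷_ (position-after-0 a b (U ∷ w))
  (trans (select-cong (valley-after U w) (length w) (position-after-U a b w)) (select-valleys U (suc a) b w))
select-valleys U a b (D ∷ w) =
  trans (select-cong (valley-after D w) (length w) (position-after-D a b w)) (select-valleys D a (suc b) w)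
select-valleys D a b (D ∷ w) =
  trans (select-cong (valley-after D w) (length w) (position-after-D a b w)) (select-valleys D a (suc b) w)

V≡positions : ∀ w → V w ≡ map position (valleys w)
V≡positions []      = refl
-- Index 0 has no letter before it, so it drops out by computation and `w′` is scanned with its
-- preceding letter.
V≡positions w@(U ∷ w′) = trans (map-filter-applyUpTo (isValley? w) _ id (length w))
  (trans (select-cong (valley-after U w′) (length w′) (position-after-U 0 0 w′)) (select-valleys U 1 0 w′))
V≡positions w@(D ∷ w′) = trans (map-filter-applyUpTo (isValley? w) _ id (length w))
  (trans (select-cong (valley-after D w′) (length w′) (position-after-D 0 0 w′)) (select-valleys D 0 1 w′))

-- Sum and difference of the coordinates determine 2a. Adding both second coordinates clears the
-- integer difference and leaves an equation in ℕ.
position-injective : ∀ {P Q} → position P ≡ position Q → P ≡ Q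
position-injective {a , b} {a′ , b′} e =
  cong₂ _,_ a≡a′ (ℕₚ.+-cancelˡ-≡ a b b′ (trans sum (cong (_+ b′) (sym a≡a′))))
  where
  sum : a + b ≡ a′ + b′
  sum = cong proj₁ e
  shift : ∀ a b c → (a ⊖ b) ℤ.+ (+ b ℤ.+ + c) ≡ + (a + c)
  shift a b c =
    trans (cong (ℤ._+ (+ b ℤ.+ + c)) (sym (ℤₚ.m-n≡m⊖n a b))) (trans (lem (+ a) (+ b) (+ c)) (sym (ℤₚ.pos-+ a c)))
    where
    lem : ∀ a b c → (a ℤ.- b) ℤ.+ (b ℤ.+ c) ≡ a ℤ.+ c
    lem = solve-∀
  cross : a + b′ ≡ a′ + b
  cross = ℤₚ.+-injective (trans (sym (shift a b b′)) (trans
    (cong₂ ℤ._+_ (cong proj₂ e) (ℤₚ.+-comm (+ b) (+ b′))) (shift a′ b′ b)))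
  a≡a′ : a ≡ a′
  a≡a′ = ℕₚ.*-cancelˡ-≡ a a′ 2 (ℕₚ.+-cancelʳ-≡ (b + b′) (2 ℕ.* a) (2 ℕ.* a′)
    (trans (lem a b b′) (trans (cong₂ _+_ sum cross) (lem′ a′ b b′))))
    where
    open +-*-Solver
    lem : ∀ a b b′ → 2 ℕ.* a + (b + b′) ≡ (a + b) + (a + b′)
    lem = solve 3 (λ a b c → con 2 :* a :+ (b :+ c) := (a :+ b) :+ (a :+ c)) refl
    lem′ : ∀ a b b′ → (a + b′) + (a + b) ≡ 2 ℕ.* a + (b + b′)
    lem′ = solve 3 (λ a b c → (a :+ c) :+ (a :+ b) := con 2 :* a :+ (b :+ c)) refl

-- Chains of lattice points and their largest refinements

infix 4 _≪_
_≪_ : Point → Point → Set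
(a , b) ≪ (a′ , b′) = a < a′ × b < b′

≪-trans : ∀ {P Q R} → P ≪ Q → Q ≪ R → P ≪ R
≪-trans (p , q) (p′ , q′) = ℕₚ.<-trans p p′ , ℕₚ.<-trans q q′

≪-irrefl : ∀ {P} → ¬ P ≪ P
≪-irrefl (p , _) = ℕₚ.<-irrefl refl p

-- One more than the number of points that fit strictly between the two ends.
gap : Point → Point → ℕ
gap (a , b) (a′ , b′) = (a′ ∸ a) ⊓ (b′ ∸ b)

gap-positive : ∀ {P Q} → P ≪ Q → 1 ≤ gap P Q
gap-positive (p , q) = ℕₚ.⊓-glb (ℕₚ.m<n⇒0<n∸m p) (ℕₚ.m<n⇒0<n∸m q)

gap-decreases : ∀ {P R Q} → P ≪ R → R ≪ Q → gap R Q < gap P Q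
gap-decreases (p , q) (p′ , q′) =
  ℕₚ.⊓-mono-≤ (ℕₚ.∸-monoʳ-< p (ℕₚ.<⇒≤ p′)) (ℕₚ.∸-monoʳ-< q (ℕₚ.<⇒≤ q′))

below-diagonal : Point → Set
below-diagonal (a , b) = b ≤ a

⊆-drop : ∀ {v : Point} {c c′} → All (v ≪_) c → c ⊆ v ∷ c′ → c ⊆ c′
⊆-drop all sub x∈c with sub x∈c
... | here refl = contradiction (All.lookup all x∈c) ≪-irrefl
... | there x∈c′ = x∈c′

data Chain (Q : Point) : Point → List Point → Set where
  end : ∀ {P} → P ≪ Q → Chain Q P []
  _∷⟨_⟩_ : ∀ {P v c} → P ≪ v → below-diagonal v → Chain Q v c → Chain Q P (v ∷ c)

gaps : Point → Point → List Point → ℕ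
gaps Q P []      = gap P Q
gaps Q P (v ∷ c) = gap P v + gaps Q v c

module _ {Q : Point} where

  Chain-≪end : ∀ {P c} → Chain Q P c → P ≪ Q
  Chain-≪end (end p)        = p
  Chain-≪end (p ∷⟨ _ ⟩ ch) = ≪-trans p (Chain-≪end ch)

  Chain-≪ : ∀ {P c} → Chain Q P c → All (P ≪_) c
  Chain-≪ (end p)        = []
  Chain-≪ (p ∷⟨ _ ⟩ ch) = p ∷ All.map (≪-trans p) (Chain-≪ ch)

  -- Walk along `c′`: a point outside `c` lowers the gap in which it lies by at least one, and a
  -- point of `c` closes a gap of at least one.
  length-bound : ∀ {P c c′} → Chain Q P c → Chain Q P c′ → c ⊆ c′ → suc (length c′) ≤ gaps Q P c
  length-bound (end p) (end _) _ = gap-positive p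
  length-bound (_ ∷⟨ _ ⟩ _) (end _) sub with sub (here refl)
  ... | ()
  length-bound (end p) (q ∷⟨ _ ⟩ ch′) sub = ℕₚ.≤-trans
    (s≤s (length-bound (end (Chain-≪end ch′)) ch′ λ ())) (gap-decreases q (Chain-≪end ch′))
  length-bound {c = v ∷ c} (p ∷⟨ δ ⟩ ch) (q ∷⟨ _ ⟩ ch′) sub with sub (here refl)
  ... | here refl  =
      ℕₚ.+-mono-≤ (gap-positive p) (length-bound ch ch′ (⊆-drop (Chain-≪ ch) (sub ∘ there)))
  ... | there v∈c′ =
      ℕₚ.≤-trans (s≤s (length-bound (r ∷⟨ δ ⟩ ch) ch′ (⊆-drop (r ∷ All.map (≪-trans r) (Chain-≪ ch)) sub)))
      (ℕₚ.+-monoˡ-≤ (gaps Q v c) (gap-decreases q r))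
    where r = All.lookup (Chain-≪ ch′) v∈c′

  next-point : List Point → Point
  next-point []      = Q
  next-point (v ∷ _) = v

  Chain-restart : ∀ {P R c} → R ≪ next-point c → Chain Q P c → Chain Q R c
  Chain-restart r (end _)          = end r
  Chain-restart r (_ ∷⟨ δ ⟩ ch) = r ∷⟨ δ ⟩ ch

  gap-diagonal : ∀ {a b R} g → gap (a , b) R ≡ suc (suc g) →
    (suc a , suc b) ≪ R × gap (suc a , suc b) R ≡ suc g
  gap-diagonal {a} {b} {x , y} g e =
    (lt a x (ℕₚ.m⊓n≤m (x ∸ a) (y ∸ b)) , lt b y (ℕₚ.m⊓n≤n (x ∸ a) (y ∸ b))) ,
    trans (cong₂ _⊓_ (sym (ℕₚ.pred[m∸n]≡m∸[1+n] x a)) (sym (ℕₚ.pred[m∸n]≡m∸[1+n] y b)))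
      (trans (pred-⊓ (x ∸ a) (y ∸ b)) (cong pred e))
    where
    2≤∸ : ∀ m n → 2 ≤ n ∸ m → suc m < n
    2≤∸ zero    n       le = le
    2≤∸ (suc m) (suc n) le = s≤s (2≤∸ m n le)
    lt : ∀ m n → gap (a , b) (x , y) ≤ n ∸ m → suc m < n
    lt m n le = 2≤∸ m n (ℕₚ.≤-trans (ℕₚ.≤-trans (s≤s (s≤s z≤n)) (ℕₚ.≤-reflexive (sym e))) le)
    pred-⊓ : ∀ m n → pred m ⊓ pred n ≡ pred (m ⊓ n)
    pred-⊓ zero    n       = refl
    pred-⊓ (suc m) zero    = ℕₚ.⊓-zeroʳ m
    pred-⊓ (suc m) (suc n) = refl

  -- A diagonal step costs exactly one unit of the gap and preserves b ≤ a, so greedy diagonal steps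
  -- from `P` use the gap up without waste.
  pad : ∀ g {P c} → below-diagonal P → Chain Q P c → gap P (next-point c) ≡ suc g →
    ∃[ c′ ] Chain Q P c′ × c ⊆ c′ × length c′ ≡ g + length c
  pad zero    {c = c} _ ch _ = c , ch , id , refl
  pad (suc g) {a , b} δ ch e =
    let r , e′ = gap-diagonal g e
        c′ , ch′ , sub , len = pad g (s≤s δ) (Chain-restart r ch) e′
    in (suc a , suc b) ∷ c′ , ((ℕₚ.≤-refl , ℕₚ.≤-refl) ∷⟨ s≤s δ ⟩ ch′) , there ∘ sub , cong suc len

  positive-gap : ∀ {P R} → P ≪ R → ∃[ g ] gap P R ≡ suc g
  positive-gap {P} {R} p with gap P R | gap-positive p
  ... | suc g | _ = g , refl

  -- The later gaps are filled first: `pad` needs only the first point of the remaining chain, and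
  -- that point stays the same. With equality here, the bound of `length-bound` is sharp.
  saturate : ∀ {P c} → below-diagonal P → Chain Q P c →
    ∃[ c′ ] Chain Q P c′ × c ⊆ c′ × suc (length c′) ≡ gaps Q P c
  saturate δ (end p) =
    let g , e = positive-gap p
        c′ , ch′ , sub , len = pad g δ (end p) e
    in c′ , ch′ , sub , trans (cong suc (trans len (ℕₚ.+-identityʳ g))) (sym e)
  saturate δ (p ∷⟨ δ′ ⟩ ch) =
    let c₁ , ch₁ , sub₁ , len₁ = saturate δ′ ch
        g , e = positive-gap p
        c′ , ch′ , sub , len = pad g δ (p ∷⟨ δ′ ⟩ ch₁) e
    in c′ , ch′ , (λ { (here eq) → sub (here eq) ; (there x∈c) → sub (there (sub₁ x∈c)) }) ,
       trans (cong suc len) (cong₂ _+_ (sym e) len₁)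

-- Every chain is the set of valleys of a Dyck path

ups downs : ℕ → Word → Word
ups   zero    w = w
ups   (suc p) w = U ∷ ups p w
downs zero    w = w
downs (suc q) w = D ∷ downs q w

valleysFrom-ups : ∀ p a b w → valleysFrom U a b (ups p w) ≡ valleysFrom U (a + p) b w
valleysFrom-ups zero    a b w = cong (λ a → valleysFrom U a b w) (sym (ℕₚ.+-identityʳ a))
valleysFrom-ups (suc p) a b w =
  trans (valleysFrom-ups p (suc a) b w) (cong (λ a → valleysFrom U a b w) (sym (ℕₚ.+-suc a p)))

valleysFrom-downs : ∀ q a b w → valleysFrom D a b (downs q w) ≡ valleysFrom D a (b + q) w
valleysFrom-downs zero    a b w = cong (λ b → valleysFrom D a b w) (sym (ℕₚ.+-identityʳ b))
valleysFrom-downs (suc q) a b w =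
  trans (valleysFrom-downs q a (suc b) w) (cong (λ b → valleysFrom D a b w) (sym (ℕₚ.+-suc b q)))

valid-ups : ∀ p h w → valid h (ups p w) ≡ valid (h + p) w
valid-ups zero    h w = cong (λ h → valid h w) (sym (ℕₚ.+-identityʳ h))
valid-ups (suc p) zero w = valid-ups p 1 w
valid-ups (suc p) (suc h) w =
  trans (valid-ups p (suc (suc h)) w) (cong (λ h → valid h w) (sym (ℕₚ.+-suc (suc h) p)))

valid-downs : ∀ q h w → valid (q + h) (downs q w) ≡ valid h w
valid-downs zero    h w = refl
valid-downs (suc q) h w = valid-downs q h w

length-ups : ∀ p w → length (ups p w) ≡ p + length w
length-ups zero    w = refl
length-ups (suc p) w = cong suc (length-ups p w)

length-downs : ∀ q w → length (downs q w) ≡ q + length w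
length-downs zero    w = refl
length-downs (suc q) w = cong suc (length-downs q w)

-- The path has left the point (b + h , b) by one U already, since a valley is recorded only in
-- front of a U; hence the successors in all three fields.
record Realization (n h b : ℕ) (c : List Point) : Set where
  constructor realization
  field
    word   : Word
    stays  : valid (suc h) word ≡ true
    points : valleysFrom U (suc (b + h)) b word ≡ c
    size   : suc (b + h) + b + length word ≡ n + n

-- Together with the U already read the block is Uᵖ⁺¹Dᑫ⁺¹, and `e` says that it ends at height `h′`.
block : ∀ {n h b p q h′ w c} → suc (b + h) + p ≡ suc b + q + h′ → valid h′ w ≡ true →
  valleysFrom D (suc b + q + h′) (suc b + q) w ≡ c → (suc b + q + h′) + (suc b + q) + length w ≡ n + n →
  Realization n h b c
block {n} {h} {b} {p} {q} {h′} {w} {c} e v pts sz = realization (ups p (D ∷ downs q w))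
  (trans (valid-ups p (suc h) (D ∷ downs q w))
    (trans (cong (λ h → valid h (downs q w)) hp) (trans (valid-downs q h′ w) v)))
  (trans (valleysFrom-ups p (suc (b + h)) b (D ∷ downs q w))
     (trans (valleysFrom-downs q (suc (b + h) + p) (suc b) w)
     (trans (cong (λ a → valleysFrom D a (suc b + q) w) e) pts)))
  (trans (cong (λ l → suc (b + h) + b + l)
    (trans (length-ups p (D ∷ downs q w)) (cong (λ l → p + suc l) (length-downs q w))))
    (trans (lem (suc (b + h)) b p q (length w)) (trans (cong (λ a → a + (suc b + q) + length w) e) sz)))
  where
  open +-*-Solver
  hp : h + p ≡ q + h′
  hp =
    ℕₚ.+-cancelˡ-≡ (suc b) (h + p) (q + h′)
      (trans (sym (ℕₚ.+-assoc (suc b) h p)) (trans e (ℕₚ.+-assoc (suc b) q h′)))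
  lem : ∀ a b p q l → a + b + (p + suc (q + l)) ≡ a + p + (suc b + q) + l
  lem = solve 5 (λ a b p q l → a :+ b :+ (p :+ (con 1 :+ (q :+ l))) := a :+ p :+ (con 1 :+ b :+ q) :+ l) refl

realize : ∀ {n} h b c → Chain (n , n) (b + h , b) c → Realization n h b c
realize h b [] (end (p , q)) with ℕₚ.m≤n⇒∃[o]m+o≡n p | ℕₚ.m≤n⇒∃[o]m+o≡n q
... | x , x≡ | y , refl =
    block {p = x} {q = y} {h′ = 0} {w = []} (trans x≡ (sym (ℕₚ.+-identityʳ _))) refl refl
        (trans (ℕₚ.+-identityʳ _) (cong (_+ (suc b + y)) (ℕₚ.+-identityʳ (suc b + y))))
realize {n} h b (v ∷ c) ((p , q) ∷⟨ δ ⟩ ch) with ℕₚ.m≤n⇒∃[o]m+o≡n p | ℕₚ.m≤n⇒∃[o]m+o≡n q | ℕₚ.m≤n⇒∃[o]m+o≡n δ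
... | x , x≡ | y , refl | h′ , refl with realize h′ (suc b + y) c ch
... | realization w v pts sz =
    block {p = x} {q = y} {h′ = h′} {w = U ∷ w} x≡ (trans (valid-U h′ w) v) (cong (_ ∷_) pts)
  (trans (ℕₚ.+-suc (suc b + y + h′ + (suc b + y)) (length w)) sz)

-- Coefficients of power series in x and y

∑ : ℕ → (ℕ → ℤ) → ℤ
∑ zero    g = g 0
∑ (suc n) g = g 0 ℤ.+ ∑ n (g ∘ suc)

sum≤≡∑ : ∀ n g → sum≤ n g ≡ ∑ n g
sum≤≡∑ zero    g = ℤₚ.+-identityʳ (g 0)
sum≤≡∑ (suc n) g = +-congˡ (g 0) (trans
  (cong (foldr ℤ._+_ (+ 0)) (trans (map-applyUpTo suc g (suc n)) (sym (map-upTo (g ∘ suc) (suc n)))))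
  (sum≤≡∑ n (g ∘ suc)))

∑-cong : ∀ n {f g : ℕ → ℤ} → (∀ k → k ≤ n → f k ≡ g k) → ∑ n f ≡ ∑ n g
∑-cong zero    e = e 0 z≤n
∑-cong (suc n) e = cong₂ ℤ._+_ (e 0 z≤n) (∑-cong n λ k k≤n → e (suc k) (s≤s k≤n))

∑-zero : ∀ n {g : ℕ → ℤ} → (∀ k → g k ≡ + 0) → ∑ n g ≡ + 0
∑-zero zero    e = e 0
∑-zero (suc n) e = cong₂ ℤ._+_ (e 0) (∑-zero n (e ∘ suc))

∑-+ : ∀ n (f g : ℕ → ℤ) → ∑ n (λ k → f k ℤ.+ g k) ≡ ∑ n f ℤ.+ ∑ n g
∑-+ zero    f g = refl
∑-+ (suc n) f g = trans (+-congˡ (f 0 ℤ.+ g 0) (∑-+ n (f ∘ suc) (g ∘ suc)))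
  (lem (f 0) (g 0) (∑ n (f ∘ suc)) _)
  where
  lem : ∀ a b c e → (a ℤ.+ b) ℤ.+ (c ℤ.+ e) ≡ (a ℤ.+ c) ℤ.+ (b ℤ.+ e)
  lem = solve-∀

∑-head : ∀ n {g : ℕ → ℤ} → (∀ k → g (suc k) ≡ + 0) → ∑ n g ≡ g 0
∑-head zero    e = refl
∑-head (suc n) {g} e = trans (+-congˡ (g 0) (∑-zero n e)) (ℤₚ.+-identityʳ (g 0))

∑-single : ∀ n m (g : ℕ → ℤ) → m ≤ n → ∑ n (λ k → g k when (k ≡ᵇ m)) ≡ g m
∑-single n       zero    g _         = ∑-head n λ _ → refl
∑-single (suc n) (suc m) g (s≤s m≤n) = trans (ℤₚ.+-identityˡ _) (∑-single n m (g ∘ suc) m≤n)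

Σ≤-coefficient : ∀ n g a b → Σ≤ n g a b ≡ ∑ n (λ k → g k a b)
Σ≤-coefficient n g a b = trans (go (upTo (suc n))) (sum≤≡∑ n (λ k → g k a b))
  where
  const0 : ∀ a b → const (+ 0) a b ≡ + 0
  const0 zero    zero    = refl
  const0 zero    (suc _) = refl
  const0 (suc _) _       = refl
  go : ∀ ks → foldr _⊕_ (const (+ 0)) (map g ks) a b ≡
              foldr ℤ._+_ (+ 0) (map (λ k → g k a b) ks)
  go []       = const0 a b
  go (k ∷ ks) = +-congˡ (g k a b) (go ks)

⊗-coefficient : ∀ p q a b → (p ⊗ q) a b ≡ ∑ a λ k → ∑ b λ l → p k l ℤ.* q (a ∸ k) (b ∸ l)
⊗-coefficient p q a b = trans (sum≤≡∑ a _) (∑-cong a λ k _ → sum≤≡∑ b _)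

0-* : ∀ {c} x → c ≡ + 0 → c ℤ.* x ≡ + 0
0-* x refl = ℤₚ.*-zeroˡ x

*-0 : ∀ c {x} → x ≡ + 0 → c ℤ.* x ≡ + 0
*-0 c refl = ℤₚ.*-zeroʳ c

const-⊗ : ∀ c p a b → (const c ⊗ p) a b ≡ c ℤ.* p a b
const-⊗ c p a b = trans (⊗-coefficient (const c) p a b) (trans
  (∑-head a λ k → ∑-zero b λ l → 0-* (p (a ∸ suc k) (b ∸ l)) refl)
  (∑-head b λ l → 0-* (p a (b ∸ suc l)) refl))

𝕩-⊗-zero : ∀ p b → (𝕩 ⊗ p) 0 b ≡ + 0
𝕩-⊗-zero p b = trans (⊗-coefficient 𝕩 p 0 b) (∑-zero b λ l → 0-* (p 0 (b ∸ l)) refl)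

𝕩-⊗-suc : ∀ p a b → (𝕩 ⊗ p) (suc a) b ≡ p a b
𝕩-⊗-suc p a b = trans (⊗-coefficient 𝕩 p (suc a) b) (trans
  (cong₂ ℤ._+_ (∑-zero b λ l → 0-* (p (suc a) (b ∸ l)) refl)
    (trans (∑-head a λ k → ∑-zero b λ l → 0-* (p (a ∸ suc k) (b ∸ l)) refl)
      (trans (∑-head b λ l → 0-* (p a (b ∸ suc l)) refl) (ℤₚ.*-identityˡ (p a b)))))
  (ℤₚ.+-identityˡ (p a b)))

𝕩^ : ∀ i a b → (𝕩 ^^ i) a b ≡ (const (+ 1) 0 b) when (i ≡ᵇ a)
𝕩^ zero    zero    b = refl
𝕩^ zero    (suc a) b = refl
𝕩^ (suc i) zero    b = 𝕩-⊗-zero (𝕩 ^^ i) b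
𝕩^ (suc i) (suc a) b = trans (𝕩-⊗-suc (𝕩 ^^ i) a b) (𝕩^ i a b)

𝕪+c-⊗-zero : ∀ c p a → ((𝕪 ⊕ const c) ⊗ p) a 0 ≡ c ℤ.* p a 0
𝕪+c-⊗-zero c p a = trans (⊗-coefficient (𝕪 ⊕ const c) p a 0) (trans
  (∑-head a λ k → 0-* (p (a ∸ suc k) 0) refl)
  (cong (ℤ._* p a 0) (ℤₚ.+-identityˡ c)))

𝕪+c-⊗-suc : ∀ c p a b → ((𝕪 ⊕ const c) ⊗ p) a (suc b) ≡ p a b ℤ.+ c ℤ.* p a (suc b)
𝕪+c-⊗-suc c p a b = trans (⊗-coefficient (𝕪 ⊕ const c) p a (suc b)) (trans
  (∑-head a λ k → ∑-zero (suc b) λ l → 0-* (p (a ∸ suc k) (suc b ∸ l)) refl)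
  (trans (+-congˡ ((+ 0 ℤ.+ c) ℤ.* p a (suc b)) (∑-head b λ l → 0-* (p a (b ∸ suc l)) refl))
    (lem c (p a (suc b)) (p a b))))
  where
  lem : ∀ c x y → (+ 0 ℤ.+ c) ℤ.* x ℤ.+ (+ 1 ℤ.+ + 0) ℤ.* y ≡ y ℤ.+ c ℤ.* x
  lem = solve-∀

-- Reading y as y + 0 lets the coefficient rules for y + c serve both y and y - 1.
𝕪-⊗ : ∀ p a b → (𝕪 ⊗ p) a b ≡ ((𝕪 ⊕ const (+ 0)) ⊗ p) a b
𝕪-⊗ p a b = trans (⊗-coefficient 𝕪 p a b) (trans
  (∑-cong a λ k _ → ∑-cong b λ l _ → cong (ℤ._* p (a ∸ k) (b ∸ l)) (sym (lem k l)))
  (sym (⊗-coefficient (𝕪 ⊕ const (+ 0)) p a b)))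
  where
  lem : ∀ k l → 𝕪 k l ℤ.+ const (+ 0) k l ≡ 𝕪 k l
  lem zero    zero    = refl
  lem zero    (suc l) = ℤₚ.+-identityʳ _
  lem (suc k) l       = ℤₚ.+-identityʳ _

𝕪^ : ∀ e b → (𝕪 ^^ e) 0 b ≡ (+ 1) when (e ≡ᵇ b)
𝕪^ zero    zero    = refl
𝕪^ zero    (suc b) = refl
𝕪^ (suc e) zero    =
  trans (𝕪-⊗ (𝕪 ^^ e) 0 0) (trans (𝕪+c-⊗-zero (+ 0) (𝕪 ^^ e) 0) (ℤₚ.*-zeroˡ ((𝕪 ^^ e) 0 0)))
𝕪^ (suc e) (suc b) = trans (𝕪-⊗ (𝕪 ^^ e) 0 (suc b)) (trans (𝕪+c-⊗-suc (+ 0) (𝕪 ^^ e) 0 b)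
  (trans (+-congˡ ((𝕪 ^^ e) 0 b) (ℤₚ.*-zeroˡ ((𝕪 ^^ e) 0 (suc b)))) (trans (ℤₚ.+-identityʳ _) (𝕪^ e b))))

eval[y-1]^-sub : ∀ e f g → eval[y-1]^ e (λ s → f s ℤ.- g s) ≡ eval[y-1]^ e f ℤ.- eval[y-1]^ e g
eval[y-1]^-cong : ∀ e {f g} → (∀ s → f s ≡ g s) → eval[y-1]^ e f ≡ eval[y-1]^ e g
eval[y-1]^-cong zero    eq = eq 0
eval[y-1]^-cong (suc e) eq = eval[y-1]^-cong e (λ s → cong₂ ℤ._-_ (eq (suc s)) (eq s))
eval[y-1]^-sub zero    f g = refl
eval[y-1]^-sub (suc e) f g = trans
  (eval[y-1]^-cong e (λ s → lem (f (suc s)) (g (suc s)) (f s) (g s)))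
  (eval[y-1]^-sub e (λ s → f (suc s) ℤ.- f s) (λ s → g (suc s) ℤ.- g s))
  where
  lem : ∀ a b c e → (a ℤ.- b) ℤ.- (c ℤ.- e) ≡ (a ℤ.- c) ℤ.- (b ℤ.- e)
  lem = solve-∀

coefficient : ℕ → ℕ → ℤ
coefficient k s = (+ 1) when (s ≡ᵇ k)

-- Pascal's rule: multiplication by y - 1 replaces a coefficient by the previous one minus itself,
-- and this is dual to the difference taken in `eval[y-1]^`.
[𝕪-1]^ : ∀ e k → ((𝕪 ⊕ const (ℤ.- + 1)) ^^ e) 0 k ≡ eval[y-1]^ e (coefficient k)
[𝕪-1]^ zero    zero    = refl
[𝕪-1]^ zero    (suc k) = refl
[𝕪-1]^ (suc e) zero    = trans (𝕪+c-⊗-zero (ℤ.- + 1) P 0) (trans (lem (P 0 0))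
  (trans (cong₂ ℤ._-_ (sym (eval0 e)) ([𝕪-1]^ e 0)) (sym (eval[y-1]^-sub e _ (coefficient 0)))))
  where
  P = (𝕪 ⊕ const (ℤ.- + 1)) ^^ e
  lem : ∀ x → (ℤ.- (+ 1)) ℤ.* x ≡ + 0 ℤ.- x
  lem = solve-∀
  eval0 : ∀ e → eval[y-1]^ e (λ _ → + 0) ≡ + 0
  eval0 zero    = refl
  eval0 (suc e) = eval0 e
[𝕪-1]^ (suc e) (suc k) = trans (𝕪+c-⊗-suc (ℤ.- + 1) P 0 k) (trans (lem (P 0 k) (P 0 (suc k)))
  (trans (cong₂ ℤ._-_ ([𝕪-1]^ e k) ([𝕪-1]^ e (suc k))) (sym (eval[y-1]^-sub e (coefficient k) (coefficient (suc k))))))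
  where
  P = (𝕪 ⊕ const (ℤ.- + 1)) ^^ e
  lem : ∀ x y → x ℤ.+ (ℤ.- + 1) ℤ.* y ≡ x ℤ.- y
  lem = solve-∀

YOnly : ℤ⟦x,y⟧ → Set
YOnly q = ∀ a b → q (suc a) b ≡ + 0

YOnly-^ : ∀ p → YOnly p → ∀ e → YOnly (p ^^ e)
YOnly-^ p py zero    a b = refl
YOnly-^ p py (suc e) a b = trans (⊗-coefficient p (p ^^ e) (suc a) b) (trans
  (∑-head (suc a) {λ k → ∑ b λ l → p k l ℤ.* (p ^^ e) (suc a ∸ k) (b ∸ l)}
    λ k → ∑-zero b λ l → 0-* ((p ^^ e) (a ∸ k) (b ∸ l)) (py k l))
  (∑-zero b λ l → *-0 (p 0 l) (YOnly-^ p py e a (b ∸ l))))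

≡ᵇ-refl : ∀ m → (m ≡ᵇ m) ≡ true
≡ᵇ-refl zero    = refl
≡ᵇ-refl (suc m) = ≡ᵇ-refl m

≢⇒≡ᵇ-false : ∀ {m n} → m ≢ n → (m ≡ᵇ n) ≡ false
≢⇒≡ᵇ-false {zero}  {zero}  m≢n = contradiction refl m≢n
≢⇒≡ᵇ-false {zero}  {suc n} m≢n = refl
≢⇒≡ᵇ-false {suc m} {zero}  m≢n = refl
≢⇒≡ᵇ-false {suc m} {suc n} m≢n = ≢⇒≡ᵇ-false (m≢n ∘ cong suc)

-- As `q` contains no x, only the summand that leaves all of xᵃ to the first factor survives.
monomial-⊗ : ∀ c i q → YOnly q → ∀ a b →
  (const c ⊗ 𝕩 ^^ i ⊗ q) a b ≡ (c ℤ.* q 0 b) when (i ≡ᵇ a)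
monomial-⊗ c i q qy a b = trans (⊗-coefficient (const c ⊗ 𝕩 ^^ i) q a b) (trans
  (∑-cong a λ k k≤a → trans (row k) (only-a k k≤a))
  (∑-single a a (λ k → (c ℤ.* q 0 b) when (i ≡ᵇ k)) ℕₚ.≤-refl))
  where
  at : ∀ k l → (const c ⊗ 𝕩 ^^ i) k l ≡ c ℤ.* ((const (+ 1) 0 l) when (i ≡ᵇ k))
  at k l = trans (const-⊗ c (𝕩 ^^ i) k l) (cong (c ℤ.*_) (𝕩^ i k l))
  push : ∀ β x → (c ℤ.* ((+ 1) when β)) ℤ.* x ≡ (c ℤ.* x) when β
  push true  x = cong (ℤ._* x) (ℤₚ.*-identityʳ c)
  push false x = 0-* x (ℤₚ.*-zeroʳ c)
  row : ∀ k → ∑ b (λ l → (const c ⊗ 𝕩 ^^ i) k l ℤ.* q (a ∸ k) (b ∸ l)) ≡ (c ℤ.* q (a ∸ k) b) when (i ≡ᵇ k)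
  row k = trans
    (∑-head b λ l → 0-* (q (a ∸ k) (b ∸ suc l)) (trans (at k (suc l)) (*-0 c (when-zero (i ≡ᵇ k)))))
    (trans (cong (ℤ._* q (a ∸ k) b) (at k 0)) (push (i ≡ᵇ k) (q (a ∸ k) b)))
  only-a : ∀ k → k ≤ a →
    (c ℤ.* q (a ∸ k) b) when (i ≡ᵇ k) ≡ ((c ℤ.* q 0 b) when (i ≡ᵇ k)) when (k ≡ᵇ a)
  only-a k k≤a with ℕₚ.m≤n⇒m<n∨m≡n k≤a
  ... | inj₂ refl rewrite ℕₚ.n∸n≡0 k | ≡ᵇ-refl k = refl
  ... | inj₁ k<a rewrite ≢⇒≡ᵇ-false (ℕₚ.<⇒≢ k<a) with a ∸ k | ℕₚ.m<n⇒0<n∸m k<a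
  ...   | suc m | _ rewrite *-0 c (qy m b) = when-zero (i ≡ᵇ k)

triangle-coefficient : ∀ r (c : ℕ → ℕ → ℤ) p → YOnly p → ∀ i k → i ≤ r →
  Σ≤ r (λ i → Σ≤ i λ j → const (c i j) ⊗ 𝕩 ^^ i ⊗ p ^^ (i ∸ j)) i k
  ≡ ∑ i (λ j → c i j ℤ.* (p ^^ (i ∸ j)) 0 k)
triangle-coefficient r c p py i k i≤r =
  trans (Σ≤-coefficient r (λ i → Σ≤ i λ j → const (c i j) ⊗ 𝕩 ^^ i ⊗ p ^^ (i ∸ j)) i k) (trans
  (∑-cong r λ i′ _ → trans (Σ≤-coefficient i′ (λ j → const (c i′ j) ⊗ 𝕩 ^^ i′ ⊗ p ^^ (i′ ∸ j)) i k)
    (trans (∑-cong i′ λ j _ → monomial-⊗ (c i′ j) i′ (p ^^ (i′ ∸ j)) (YOnly-^ p py (i′ ∸ j)) i k)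
      (pull i′ (i′ ≡ᵇ i))))
  (∑-single r i (λ i′ → ∑ i′ (λ j → c i′ j ℤ.* (p ^^ (i′ ∸ j)) 0 k)) i≤r))
  where
  pull : ∀ i′ β → ∑ i′ (λ j → (c i′ j ℤ.* (p ^^ (i′ ∸ j)) 0 k) when β) ≡
                  (∑ i′ (λ j → c i′ j ℤ.* (p ^^ (i′ ∸ j)) 0 k)) when β
  pull i′ true  = refl
  pull i′ false = ∑-zero i′ λ _ → refl

-- Entries of the h-triangle in terms of the f-triangle

∸-≡ᵇ : ∀ i j j′ → j ≤ i → j′ ≤ i → (i ∸ j′ ≡ᵇ i ∸ j) ≡ (j′ ≡ᵇ j)
∸-≡ᵇ i j j′ j≤i j′≤i with j′ ≟ j
... | yes refl = trans (≡ᵇ-refl (i ∸ j)) (sym (≡ᵇ-refl j))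
... | no j′≢j  = trans (≢⇒≡ᵇ-false (j′≢j ∘ ℕₚ.∸-cancelˡ-≡ j′≤i j≤i)) (sym (≢⇒≡ᵇ-false j′≢j))

module _ {A : Set} (_≟_ : DecidableEquality A) (Δ : List (List A)) where
  open Complex {A} _≟_ Δ

  -- Compare the coefficients of xⁱyⁱ⁻ʲ. The bound by `rank` puts row i into the outer sum, and on
  -- the h-side the exponent i ∸ j′ determines j′ because j′ ≤ i.
  h-formula : ∀ h → IsHTriangle h → ∀ i j → j ≤ i → i ≤ rank →
    h i j ≡ ∑ i (λ j′ → + f i j′ ℤ.* eval[y-1]^ (i ∸ j′) (coefficient (i ∸ j)))
  h-formula h isH i j j≤i i≤r = begin
    h i j
      ≡⟨ ∑-single i j (h i) j≤i ⟨
    ∑ i (λ j′ → h i j′ when (j′ ≡ᵇ j))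
      ≡⟨ ∑-cong i (λ j′ j′≤i → sym (trans (cong (h i j′ ℤ.*_) (𝕪^ (i ∸ j′) (i ∸ j)))
           (trans (*-when (h i j′) (i ∸ j′ ≡ᵇ i ∸ j)) (cong (h i j′ when_) (∸-≡ᵇ i j j′ j≤i j′≤i))))) ⟩
    ∑ i (λ j′ → h i j′ ℤ.* (𝕪 ^^ (i ∸ j′)) 0 (i ∸ j))
      ≡⟨ triangle-coefficient rank h 𝕪 (λ _ _ → refl) i (i ∸ j) i≤r ⟨
    _ ≡⟨ isH i (i ∸ j) ⟩
    _ ≡⟨ triangle-coefficient rank (λ i j → + f i j) (𝕪 ⊕ const (ℤ.- + 1)) (λ _ _ → refl) i (i ∸ j) i≤r ⟩
    ∑ i (λ j′ → + f i j′ ℤ.* ((𝕪 ⊕ const (ℤ.- + 1)) ^^ (i ∸ j′)) 0 (i ∸ j))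
      ≡⟨ ∑-cong i (λ j′ _ → cong (+ f i j′ ℤ.*_) ([𝕪-1]^ (i ∸ j′) (i ∸ j))) ⟩
    ∑ i (λ j′ → + f i j′ ℤ.* eval[y-1]^ (i ∸ j′) (coefficient (i ∸ j))) ∎
    where
    open ≡-Reasoning
    *-when : ∀ c β → c ℤ.* ((+ 1) when β) ≡ c when β
    *-when c true  = ℤₚ.*-identityʳ c
    *-when c false = ℤₚ.*-zeroʳ c

-- Dyck words: the Boolean test and the enumeration

valid⇒# : ∀ h w → valid h w ≡ true → h + # U w ≡ # D w
valid⇒# zero    []      v = refl
valid⇒# h       (U ∷ w) v =
  trans (ℕₚ.+-suc h (# U w)) (valid⇒# (suc h) w (trans (sym (valid-U h w)) v))
valid⇒# (suc h) (D ∷ w) v = cong suc (valid⇒# h w v)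

valid⇒inits : ∀ h w → valid h w ≡ true → All (λ p → # D p ≤ h + # U p) (inits w)
valid⇒inits h       []      v = z≤n ∷ []
valid⇒inits h       (U ∷ w) v =
  z≤n ∷ Allₚ.map⁺ (All.map (λ {p} le → subst (# D p ≤_) (sym (ℕₚ.+-suc h (# U p))) le)
  (valid⇒inits (suc h) w (trans (sym (valid-U h w)) v)))
valid⇒inits (suc h) (D ∷ w) v = z≤n ∷ Allₚ.map⁺ (All.map s≤s (valid⇒inits h w v))

⇒valid : ∀ h w → h + # U w ≡ # D w → All (λ p → # D p ≤ h + # U p) (inits w) → valid h w ≡ true
⇒valid zero    []      e ps = refl
⇒valid h       (U ∷ w) e (_ ∷ ps) =
  trans (valid-U h w) (⇒valid (suc h) w (trans (sym (ℕₚ.+-suc h (# U w))) e)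
  (All.map (λ {p} le → subst (# D p ≤_) (ℕₚ.+-suc h (# U p)) le) (Allₚ.map⁻ ps)))
⇒valid zero    (D ∷ w) e (_ ∷ () ∷ _)
⇒valid (suc h) (D ∷ w) e (_ ∷ ps) =
  ⇒valid h w (ℕₚ.suc-injective e) (All.map ℕₚ.≤-pred (Allₚ.map⁻ ps))

#-length : ∀ w → # U w + # D w ≡ length w
#-length []      = refl
#-length (U ∷ w) = cong suc (#-length w)
#-length (D ∷ w) = trans (ℕₚ.+-suc (# U w) (# D w)) (cong suc (#-length w))

∈-words : ∀ w → w ∈ words (length w)
∈-words []      = here refl
∈-words (U ∷ w) =
  ∈-cartesianProductWith⁺ _∷_ {xs = U ∷ D ∷ []} {ys = words (length w)} (here refl) (∈-words w)
∈-words (D ∷ w) =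
  ∈-cartesianProductWith⁺ _∷_ {xs = U ∷ D ∷ []} {ys = words (length w)} (there (here refl)) (∈-words w)

words-length : ∀ k {w} → w ∈ words k → length w ≡ k
words-length zero    (here refl) = refl
words-length (suc k) w∈ with ∈-cartesianProductWith⁻ _∷_ (U ∷ D ∷ []) (words k) w∈
... | _ , _ , _ , w′∈ , refl = cong suc (words-length k w′∈)

words-unique : ∀ k → Unique (words k)
words-unique zero    = [] ∷ []
words-unique (suc k) = Uniqueₚ.cartesianProductWith⁺ _∷_ (λ { refl → refl , refl })
  (((λ ()) ∷ []) ∷ ([] ∷ [])) (words-unique k)

record IsDyckOf (n : ℕ) (w : Word) : Set where
  constructor isDyckOf
  field
    isValid : valid 0 w ≡ true
    size    : length w ≡ n + n
open IsDyckOf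

2*n≡n+n : ∀ n → 2 ℕ.* n ≡ n + n
2*n≡n+n n = cong (λ m → n + m) (ℕₚ.+-identityʳ n)

∈-Dyck⁻ : ∀ n {w} → w ∈ Dyck n → IsDyckOf n w
∈-Dyck⁻ n {w} w∈ with ∈-filter⁻ isDyck? {xs = words (2 ℕ.* n)} w∈
... | w∈words , e , ps = isDyckOf (⇒valid 0 w e ps) (trans (words-length _ w∈words) (2*n≡n+n n))

∈-Dyck⁺ : ∀ n {w} → IsDyckOf n w → w ∈ Dyck n
∈-Dyck⁺ n {w} (isDyckOf v s) = ∈-filter⁺ isDyck?
  (subst (λ k → w ∈ words k) (trans s (sym (2*n≡n+n n))) (∈-words w)) (valid⇒# 0 w v , valid⇒inits 0 w v)

#U≡n : ∀ {n w} → IsDyckOf n w → # U w ≡ n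
#U≡n {n} {w} (isDyckOf v s) = ℕₚ.*-cancelˡ-≡ (# U w) n 2 (trans (2*n≡n+n (# U w))
  (trans (cong (λ m → # U w + m) (valid⇒# 0 w v)) (trans (#-length w) (trans s (sym (2*n≡n+n n))))))

#D≡n : ∀ {n w} → IsDyckOf n w → # D w ≡ n
#D≡n {w = w} dy = trans (sym (valid⇒# 0 w (isValid dy))) (#U≡n dy)

-- The chain of valleys of a Dyck path and its block statistics

Chain-U : ∀ {X Y} A B a b h w → valid (suc h) w ≡ true → A < a → B ≤ b → b + suc h ≡ a →
  a + # U w ≡ X → b + # D w ≡ Y → Chain (X , Y) (A , B) (valleysFrom U a b w)
Chain-D : ∀ {X Y} A B a b h w → valid h w ≡ true → A < a → B < b → b + h ≡ a →
  a + # U w ≡ X → b + # D w ≡ Y → Chain (X , Y) (A , B) (valleysFrom D a b w)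
Chain-U A B a b h (U ∷ w) v p q e x≡ y≡ = Chain-U A B (suc a) b (suc h) w v (ℕₚ.m<n⇒m<1+n p) q
  (trans (ℕₚ.+-suc b (suc h)) (cong suc e)) (trans (sym (ℕₚ.+-suc a (# U w))) x≡) y≡
Chain-U A B a b h (D ∷ w) v p q e x≡ y≡ = Chain-D A B a (suc b) h w v p (s≤s q)
  (trans (sym (ℕₚ.+-suc b h)) e) x≡ (trans (sym (ℕₚ.+-suc b (# D w))) y≡)
Chain-D A B a b h [] v p q e refl refl =
  end (subst (A <_) (sym (ℕₚ.+-identityʳ a)) p , subst (B <_) (sym (ℕₚ.+-identityʳ b)) q)
Chain-D A B a b h (U ∷ w) v p q e x≡ y≡ = (p , q) ∷⟨ subst (b ≤_) e (ℕₚ.m≤m+n b h) ⟩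
  Chain-U a b (suc a) b h w (trans (sym (valid-U h w)) v) ℕₚ.≤-refl ℕₚ.≤-refl (trans (ℕₚ.+-suc b h) (cong suc e))
    (trans (sym (ℕₚ.+-suc a (# U w))) x≡) y≡
Chain-D A B a b (suc h) (D ∷ w) v p q e x≡ y≡ = Chain-D A B a (suc b) h w v p (ℕₚ.m<n⇒m<1+n q)
  (trans (sym (ℕₚ.+-suc b h)) e) x≡ (trans (sym (ℕₚ.+-suc b (# D w))) y≡)

-- A further D raises p ⊓ q precisely while p ∸ q, the number kept by `down`, is positive.
minSum-D : ∀ p q w → p ⊓ suc q + minSum (down (p ∸ suc q)) w ≡ p ⊓ q + minSum (down (p ∸ q)) (D ∷ w)
minSum-D zero    zero    w = refl
minSum-D zero    (suc q) w = refl
minSum-D (suc p) zero    w rewrite ℕₚ.⊓-zeroʳ p = refl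
minSum-D (suc p) (suc q) w = cong suc (minSum-D p q w)

-- Here p and q are the lengths of the runs since the last valley, so the gap closed by the next
-- valley is the p ⊓ q of the block between them.
gaps-U : ∀ {X Y} A b p w → p + A + # U w ≡ X → b + # D w ≡ Y →
  gaps (X , Y) (A , b) (valleysFrom U (p + A) b w) ≡ minSum (up p) w
gaps-D : ∀ {X Y} A B p q w → p + A + # U w ≡ X → q + B + # D w ≡ Y →
  gaps (X , Y) (A , B) (valleysFrom D (p + A) (q + B) w) ≡ p ⊓ q + minSum (down (p ∸ q)) w
gaps-U A b p [] refl refl rewrite ℕₚ.+-identityʳ b | ℕₚ.n∸n≡0 b = ℕₚ.⊓-zeroʳ (p + A + 0 ∸ A)
gaps-U A b p (U ∷ w) x≡ y≡ = gaps-U A b (suc p) w (trans (sym (ℕₚ.+-suc (p + A) (# U w))) x≡) y≡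
gaps-U A b zero (D ∷ w) x≡ y≡ = gaps-D A b 0 1 w x≡ (trans (sym (ℕₚ.+-suc b (# D w))) y≡)
gaps-U A b (suc zero) (D ∷ w) x≡ y≡ =
  trans (gaps-D A b 1 1 w x≡ (trans (sym (ℕₚ.+-suc b (# D w))) y≡)) (cong suc (sym (minSum-peak w)))
gaps-U A b (suc (suc p)) (D ∷ w) x≡ y≡ =
  gaps-D A b (suc (suc p)) 1 w x≡ (trans (sym (ℕₚ.+-suc b (# D w))) y≡)
gaps-D A B p q [] refl refl rewrite ℕₚ.+-identityʳ (p + A) | ℕₚ.+-identityʳ (q + B) | ℕₚ.m+n∸n≡m p A | ℕₚ.m+n∸n≡m q B =
  sym (ℕₚ.+-identityʳ (p ⊓ q))
gaps-D A B p q (U ∷ w) x≡ y≡ = cong₂ _+_ (cong₂ _⊓_ (ℕₚ.m+n∸n≡m p A) (ℕₚ.m+n∸n≡m q B))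
  (gaps-U (p + A) (q + B) 1 w (trans (sym (ℕₚ.+-suc (p + A) (# U w))) x≡) y≡)
gaps-D A B p q (D ∷ w) x≡ y≡ =
  trans (gaps-D A B p (suc q) w x≡ (trans (sym (ℕₚ.+-suc (q + B) (# D w))) y≡)) (minSum-D p q w)

-- Each block adds one more to `minSum` than to `excess`, and each block except the last ends in a
-- valley. Validity makes sure that an open U-run does reach its D.
minSum-up : ∀ p h a b w → valid (suc h) w ≡ true →
  minSum (up (suc p)) w ≡ suc (excess (up (suc p)) w + length (valleysFrom U a b w))
minSum-down : ∀ r h a b w → valid h w ≡ true →
  minSum (down r) w ≡ excess (down r) w + length (valleysFrom D a b w)
minSum-up p h a b (U ∷ w) v = minSum-up (suc p) (suc h) (suc a) b w v
minSum-up zero h a b (D ∷ w) v =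
  cong suc (trans (minSum-peak w) (trans (minSum-down 0 h a (suc b) w v)
    (cong (_+ length (valleysFrom D a (suc b) w)) (sym (excess-peak w)))))
minSum-up (suc p) h a b (D ∷ w) v = cong suc (minSum-down (suc p) h a (suc b) w v)
minSum-down r zero a b [] v = refl
minSum-down r h a b (U ∷ w) v =
  trans (minSum-up 0 h (suc a) b w (trans (sym (valid-U h w)) v)) (sym (ℕₚ.+-suc (excess (up 1) w) _))
minSum-down zero (suc h) a b (D ∷ w) v = minSum-down 0 h a (suc b) w v
minSum-down (suc r) (suc h) a b (D ∷ w) v = cong suc (minSum-down r h a (suc b) w v)

Dyck⇒Chain : ∀ {n w} → 1 ≤ n → IsDyckOf n w → Chain (n , n) (0 , 0) (valleys w)
Dyck⇒Chain {w = []} (s≤s _) dy with size dy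
... | ()
Dyck⇒Chain {w = U ∷ w} _ dy = Chain-U 0 0 1 0 0 w (isValid dy) (s≤s z≤n) z≤n refl (#U≡n dy) (#D≡n dy)
Dyck⇒Chain {w = D ∷ w} _ dy with isValid dy
... | ()

Dyck-gaps : ∀ {n w} → IsDyckOf n w → gaps (n , n) (0 , 0) (valleys w) ≡ minSum (up 0) w
Dyck-gaps {w = w} dy = gaps-U 0 0 0 w (#U≡n dy) (#D≡n dy)

Dyck-minSum : ∀ {n w} → 1 ≤ n → IsDyckOf n w → minSum (up 0) w ≡ suc (excess (up 0) w + length (valleys w))
Dyck-minSum {w = []} (s≤s _) dy with size dy
... | ()
Dyck-minSum {w = U ∷ w} _ dy = minSum-up 0 0 1 0 w (isValid dy)
Dyck-minSum {w = D ∷ w} _ dy with isValid dy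
... | ()

Chain⇒Dyck : ∀ {n c} → Chain (n , n) (0 , 0) c → ∃[ w ] IsDyckOf n w × valleys w ≡ c
Chain⇒Dyck {c = c} ch with realize 0 0 c ch
... | realization w v pts sz = U ∷ w , isDyckOf v sz , pts

-- A Dyck path is determined by its valleys

valleysFrom-≥ : ∀ s a b w → All (λ v → a ≤ proj₁ v × b ≤ proj₂ v) (valleysFrom s a b w)
valleysFrom-≥ s a b [] = []
valleysFrom-≥ U a b (U ∷ w) = All.map (λ (p , q) → ℕₚ.<⇒≤ p , q) (valleysFrom-≥ U (suc a) b w)
valleysFrom-≥ D a b (U ∷ w) =
  (ℕₚ.≤-refl , ℕₚ.≤-refl) ∷ All.map (λ (p , q) → ℕₚ.<⇒≤ p , q) (valleysFrom-≥ U (suc a) b w)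
valleysFrom-≥ U a b (D ∷ w) = All.map (λ (p , q) → p , ℕₚ.<⇒≤ q) (valleysFrom-≥ D a (suc b) w)
valleysFrom-≥ D a b (D ∷ w) = All.map (λ (p , q) → p , ℕₚ.<⇒≤ q) (valleysFrom-≥ D a (suc b) w)

valleysFrom-D-head : ∀ a b w {v c} → valleysFrom D a b w ≡ v ∷ c → proj₁ v ≡ a
valleysFrom-D-head a b (U ∷ w) refl = refl
valleysFrom-D-head a b (D ∷ w) e    = valleysFrom-D-head a (suc b) w e

no-valley⇒length : ∀ h a b w → valid h w ≡ true → valleysFrom D a b w ≡ [] → length w ≡ h
no-valley⇒length zero    a b []      v e = refl
no-valley⇒length zero    a b (U ∷ w) v ()
no-valley⇒length zero    a b (D ∷ w) () e
no-valley⇒length (suc h) a b (D ∷ w) v e = cong suc (no-valley⇒length h a (suc b) w v e)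

valid⇒≤length : ∀ h w → valid h w ≡ true → h ≤ length w
valid⇒≤length h w v = subst (h ≤_) (#-length w) (ℕₚ.≤-trans (ℕₚ.m≤m+n h (# U w))
  (ℕₚ.≤-trans (ℕₚ.≤-reflexive (valid⇒# h w v)) (ℕₚ.m≤n+m (# D w) (# U w))))

-- After a D, turning up makes (a , b) a valley, while going down leaves only valleys with second
-- coordinate above b. After a U, the path turning down has its first valley at first coordinate a,
-- too small for the other path; if it has none, it is a bare descent, too short for a path that
-- still goes up.
U-D-differ : ∀ s h a b w w′ → valid h (U ∷ w) ≡ true → valid h (D ∷ w′) ≡ true → length w ≡ length w′ →
  valleysFrom s a b (U ∷ w) ≢ valleysFrom s a b (D ∷ w′)
U-D-differ D h a b w w′ v v′ len e with subst (All _) (sym e) (valleysFrom-≥ D a (suc b) w′)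
... | (_ , p) ∷ _ = ℕₚ.<-irrefl refl p
U-D-differ U (suc h) a b w w′ v v′ len e with valleysFrom D a (suc b) w′ in eq
... | [] =
    ℕₚ.<⇒≱ (ℕₚ.m<n⇒m<1+n (s≤s (ℕₚ.≤-reflexive (trans len (no-valley⇒length h a (suc b) w′ v′ eq)))))
      (valid⇒≤length (suc (suc h)) w v)
... | x ∷ _ with subst (All _) e (valleysFrom-≥ U (suc a) b w)
...   | (p , _) ∷ _ = ℕₚ.<-irrefl (sym (valleysFrom-D-head a (suc b) w′ eq)) p

valleysFrom-injective : ∀ s h a b w w′ → valid h w ≡ true → valid h w′ ≡ true → length w ≡ length w′ →
  valleysFrom s a b w ≡ valleysFrom s a b w′ → w ≡ w′
valleysFrom-injective s h a b []      []       v v′ len e = refl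
valleysFrom-injective U h a b (U ∷ w) (U ∷ w′) v v′ len e =
  cong (U ∷_) (valleysFrom-injective U (suc h) (suc a) b w w′
  (trans (sym (valid-U h w)) v) (trans (sym (valid-U h w′)) v′) (ℕₚ.suc-injective len) e)
valleysFrom-injective D h a b (U ∷ w) (U ∷ w′) v v′ len e =
  cong (U ∷_) (valleysFrom-injective U (suc h) (suc a) b w w′
  (trans (sym (valid-U h w)) v) (trans (sym (valid-U h w′)) v′) (ℕₚ.suc-injective len) (∷-injectiveʳ e))
valleysFrom-injective U (suc h) a b (D ∷ w) (D ∷ w′) v v′ len e =
  cong (D ∷_) (valleysFrom-injective D h a (suc b) w w′ v v′ (ℕₚ.suc-injective len) e)
valleysFrom-injective D (suc h) a b (D ∷ w) (D ∷ w′) v v′ len e =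
  cong (D ∷_) (valleysFrom-injective D h a (suc b) w w′ v v′ (ℕₚ.suc-injective len) e)
valleysFrom-injective s h a b (U ∷ w) (D ∷ w′) v v′ len e =
  contradiction e (U-D-differ s h a b w w′ v v′ (ℕₚ.suc-injective len))
valleysFrom-injective s h a b (D ∷ w) (U ∷ w′) v v′ len e =
  contradiction (sym e) (U-D-differ s h a b w′ w v′ v (ℕₚ.suc-injective (sym len)))

V-injective : ∀ {n w w′} → IsDyckOf n w → IsDyckOf n w′ → V w ≡ V w′ → w ≡ w′
V-injective {w = w} {w′} dy dy′ e =
  valleysFrom-injective U 0 0 0 w w′ (isValid dy) (isValid dy′) (trans (size dy) (sym (size dy′)))
  (map-injective position-injective (trans (sym (V≡positions w)) (trans e (V≡positions w′))))

map-unique : ∀ {A B : Set} {f : A → B} {xs} → (∀ {x y} → x ∈ xs → y ∈ xs → f x ≡ f y → x ≡ y) →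
  Unique xs → Unique (map f xs)
map-unique inj [] = []
map-unique inj (x∉ ∷ un) =
  Allₚ.map⁺ (All.tabulate λ y∈ e → All.lookup x∉ y∈ (inj (here refl) (there y∈) e)) ∷
  map-unique (λ p q → inj (there p) (there q)) un

deduplicate-unique : ∀ {A : Set} (_≟_ : DecidableEquality A) {xs} → Unique xs → deduplicate _≟_ xs ≡ xs
deduplicate-unique _≟_ [] = refl
deduplicate-unique _≟_ {x ∷ xs} (x∉ ∷ un) =
  cong (x ∷_) (trans (cong (filter (¬? ∘ (x ≟_))) (deduplicate-unique _≟_ un))
  (filter-all (¬? ∘ (x ≟_)) x∉))

-- Since `V` is injective on Dyck paths, sums over faces become sums over paths.
ΔDyck≡ : ∀ n → ΔDyck n ≡ map V (Dyck n)
ΔDyck≡ n = deduplicate-unique _ (map-unique (λ p q → V-injective (∈-Dyck⁻ n p) (∈-Dyck⁻ n q))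
  (Uniqueₚ.filter⁺ isDyck? (words-unique (2 ℕ.* n))))

-- Successive valleys and blocks UD

_≟ᴾ_ : DecidableEquality Point
_≟ᴾ_ = Product.≡-dec ℕ._≟_ ℕ._≟_

diag : Point → Point
diag (a , b) = suc a , suc b

-- A local form of `Successive`: each valley is compared with its predecessor only, not with the
-- whole list.
adjacent : Point → List Point → ℕ
adjacent P []      = 0
adjacent P (v ∷ c) = (if does (v ≟ᴾ diag P) then suc else id) (adjacent v c)

is-diag : ∀ A B p q → does ((p + A , suc q + B) ≟ᴾ diag (A , B)) ≡ (p ≡ᵇ 1) ∧ (q ≡ᵇ 0)
is-diag A B p q = does-⇔ (mk⇔
  (λ e → ℕₚ.+-cancelʳ-≡ A p 1 (cong proj₁ e) , ℕₚ.+-cancelʳ-≡ B q 0 (ℕₚ.suc-injective (cong proj₂ e)))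
  (λ { (refl , refl) → refl }))
  ((p + A , suc q + B) ≟ᴾ diag (A , B)) ((p ≟ 1) ×-dec (q ≟ 0))

after-block : Bool → State
after-block true  = peak
after-block false = down 0

singles-D : ∀ β w → singles (after-block β) (D ∷ w) ≡ singles (down 0) w
singles-D true  w = refl
singles-D false w = refl

adjacent-U : ∀ A b p w → adjacent (A , b) (valleysFrom U (p + A) b w) ≡ singles (up p) w
adjacent-D : ∀ A B p q w →
  adjacent (A , B) (valleysFrom D (p + A) (suc q + B) w) ≡ singles (after-block ((p ≡ᵇ 1) ∧ (q ≡ᵇ 0))) w
adjacent-U A b p [] = refl
adjacent-U A b p (U ∷ w) = adjacent-U A b (suc p) w
adjacent-U A b zero (D ∷ w) = adjacent-D A b 0 0 w
adjacent-U A b (suc zero) (D ∷ w) = adjacent-D A b 1 0 w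
adjacent-U A b (suc (suc p)) (D ∷ w) =
  trans (adjacent-D A b (suc (suc p)) 0 w) (singles-down 0 (suc p) w)
adjacent-D A B p q [] = sym (singles-[] ((p ≡ᵇ 1) ∧ (q ≡ᵇ 0)))
  where
  singles-[] : ∀ β → singles (after-block β) [] ≡ 0
  singles-[] true  = refl
  singles-[] false = refl
adjacent-D A B p q (U ∷ w) rewrite is-diag A B p q | adjacent-U (p + A) (suc q + B) 1 w
  with (p ≡ᵇ 1) ∧ (q ≡ᵇ 0)
... | true  = refl
... | false = refl
adjacent-D A B p q (D ∷ w) = trans (adjacent-D A B p (suc q) w)
  (trans (cong (λ β → singles (after-block β) w) (∧-zeroʳ (p ≡ᵇ 1))) (sym (singles-D ((p ≡ᵇ 1) ∧ (q ≡ᵇ 0)) w)))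

-- No point lies strictly between `e` and `diag e` in both coordinates, so a valley `diag e` with
-- `e` in `L` can only have `e` as its predecessor. The last hypothesis is the invariant that leaves
-- no other candidates for `e` than points before `P`, `P` itself and the rest of the chain.
count-adjacent : ∀ {Q} {S : Position → Set} (S? : Decidable S) (L : List Point) →
  (∀ v → S (position v) → ∃[ e ] e ∈ L × v ≡ diag e) → (∀ e → e ∈ L → S (position (diag e))) →
  ∀ {P c} → Chain Q P c → P ∈ L → c ⊆ L → (∀ e → e ∈ L → e ≪ P ⊎ e ∈ P ∷ c) →
  length (filter S? (map position c)) ≡ adjacent P c
count-adjacent S? L from to (end _) P∈ c⊆ cover = refl
count-adjacent S? L from to {P} {v ∷ c} (p ∷⟨ _ ⟩ ch) P∈ c⊆ cover
  with S? (position v) | v ≟ᴾ diag P | count-adjacent S? L from to ch (c⊆ (here refl)) (c⊆ ∘ there) cover′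
  where
  cover′ : ∀ e → e ∈ L → e ≪ v ⊎ e ∈ v ∷ c
  cover′ e e∈ with cover e e∈
  ... | inj₁ e≪P          = inj₁ (≪-trans e≪P p)
  ... | inj₂ (here refl)  = inj₁ p
  ... | inj₂ (there e∈vc) = inj₂ e∈vc
... | yes _ | yes _ | ih = cong suc ih
... | no _  | no _  | ih = ih
... | no ¬s | yes refl | _ = contradiction (to P P∈) ¬s
... | yes s | no v≢ | _ with from v s
...   | e , e∈ , refl with cover e e∈
...     | inj₁ (e<P , _)           = contradiction (proj₁ p) (ℕₚ.≤⇒≯ e<P)
...     | inj₂ (here refl)         = contradiction refl v≢
...     | inj₂ (there (here eq))   = contradiction (sym (cong proj₁ eq)) ℕₚ.1+n≢n
...     | inj₂ (there (there e∈c)) =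
    contradiction (proj₁ (All.lookup (Chain-≪ ch) e∈c)) (ℕₚ.≤⇒≯ (ℕₚ.n≤1+n _))

position-diag : ∀ e → position (diag e) ≡ (2 + proj₁ (position e) , proj₂ (position e))
position-diag (a , b) = cong₂ _,_ (cong suc (ℕₚ.+-suc a b)) (ℤₚ.[1+m]⊖[1+n]≡m⊖n a b)

sucᵛ≡singles : ∀ {n w} → 1 ≤ n → IsDyckOf n w → sucᵛ w ≡ singles (up 0) w
sucᵛ≡singles {n} {w} 1≤n dy = trans
  (trans (cong (length ∘ filter (successive? w)) (V≡positions w))
    (count-adjacent (successive? w) L from to (Dyck⇒Chain 1≤n dy) (here refl) there (λ e e∈ → inj₂ e∈)))
  (adjacent-U 0 0 0 w)
  where
  L : List Point
  L = (0 , 0) ∷ valleys w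
  L≡ : (0 , + 0) ∷ V w ≡ map position L
  L≡ = cong (position (0 , 0) ∷_) (V≡positions w)
  from : ∀ v → Successive w (position v) → ∃[ e ] e ∈ L × v ≡ diag e
  from v s with find s
  ... | e′ , e′∈ , x≡ , y≡ with ∈-map⁻ position {xs = L} (subst (e′ ∈_) L≡ e′∈)
  ...   | e , e∈ , refl =
      e , e∈ , position-injective {v} {diag e} (trans (cong₂ _,_ x≡ y≡) (sym (position-diag e)))
  to : ∀ e → e ∈ L → Successive w (position (diag e))
  to e e∈ =
    lose (subst (position e ∈_) (sym L≡) (∈-map⁺ position e∈))
      (cong proj₁ (position-diag e) , cong proj₂ (position-diag e))

-- Degrees and maximal faces

⊆⇒≡⊎< : ∀ {Q P c c′} → Chain Q P c → Chain Q P c′ → c ⊆ c′ → c ≡ c′ ⊎ length c < length c′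
⊆⇒≡⊎< (end _) (end _) sub = inj₁ refl
⊆⇒≡⊎< (end _) (_ ∷⟨ _ ⟩ _) sub = inj₂ (s≤s z≤n)
⊆⇒≡⊎< (_ ∷⟨ _ ⟩ _) (end _) sub with sub (here refl)
... | ()
⊆⇒≡⊎< (p ∷⟨ δ ⟩ ch) (q ∷⟨ _ ⟩ ch′) sub with sub (here refl)
... | here refl with ⊆⇒≡⊎< ch ch′ (⊆-drop (Chain-≪ ch) (sub ∘ there))
...   | inj₁ refl = inj₁ refl
...   | inj₂ lt   = inj₂ (s≤s lt)
⊆⇒≡⊎< (p ∷⟨ δ ⟩ ch) (q ∷⟨ _ ⟩ ch′) sub | there v∈c′
  with ⊆⇒≡⊎< (r ∷⟨ δ ⟩ ch) ch′ (⊆-drop (r ∷ All.map (≪-trans r) (Chain-≪ ch)) sub)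
  where r = All.lookup (Chain-≪ ch′) v∈c′
...   | inj₁ refl = inj₂ ℕₚ.≤-refl
...   | inj₂ lt   = inj₂ (ℕₚ.m<n⇒m<1+n lt)

V-⊆⁻ : ∀ w w′ → V w ⊆ V w′ → valleys w ⊆ valleys w′
V-⊆⁻ w w′ sub {x} x∈ with ∈-map⁻ position (subst (position x ∈_) (V≡positions w′)
  (sub (subst (position x ∈_) (sym (V≡positions w)) (∈-map⁺ position x∈))))
... | y , y∈ , e with position-injective {x} {y} e
...   | refl = y∈

V-⊆⁺ : ∀ w w′ → valleys w ⊆ valleys w′ → V w ⊆ V w′
V-⊆⁺ w w′ sub {x} x∈ with ∈-map⁻ position (subst (x ∈_) (V≡positions w) x∈)
... | y , y∈ , refl = subst (position y ∈_) (sym (V≡positions w′)) (∈-map⁺ position (sub y∈))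

length-V : ∀ w → length (V w) ≡ length (valleys w)
length-V w = trans (cong length (V≡positions w)) (length-map position (valleys w))

∈-Δ⁺ : ∀ {n w} → IsDyckOf n w → V w ∈ ΔDyck n
∈-Δ⁺ {n} {w} dy = subst (V w ∈_) (sym (ΔDyck≡ n)) (∈-map⁺ V (∈-Dyck⁺ n dy))

∈-Δ⁻ : ∀ {n τ} → τ ∈ ΔDyck n → ∃[ w ] IsDyckOf n w × τ ≡ V w
∈-Δ⁻ {n} {τ} τ∈ with ∈-map⁻ V (subst (τ ∈_) (ΔDyck≡ n) τ∈)
... | w , w∈ , e = w , ∈-Dyck⁻ n w∈ , e

degree : Word → ℕ
degree w = excess (up 0) w + length (valleys w)

length≤degree : ∀ {n w w′} → 1 ≤ n → IsDyckOf n w → IsDyckOf n w′ → valleys w ⊆ valleys w′ →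
  length (valleys w′) ≤ degree w
length≤degree 1≤n dy dy′ sub = ℕₚ.≤-pred (ℕₚ.≤-trans
  (length-bound (Dyck⇒Chain 1≤n dy) (Dyck⇒Chain 1≤n dy′) sub)
  (ℕₚ.≤-reflexive (trans (Dyck-gaps dy) (Dyck-minSum 1≤n dy))))

saturated : ∀ {n w} → 1 ≤ n → IsDyckOf n w →
  ∃[ w′ ] IsDyckOf n w′ × valleys w ⊆ valleys w′ × length (valleys w′) ≡ degree w
saturated 1≤n dy with saturate z≤n (Dyck⇒Chain 1≤n dy)
... | c′ , ch′ , sub , len with Chain⇒Dyck ch′
...   | w′ , dy′ , refl =
    w′ , dy′ , sub , ℕₚ.suc-injective (trans len (trans (Dyck-gaps dy) (Dyck-minSum 1≤n dy)))

deg≡degree : ∀ {n w} → 1 ≤ n → IsDyckOf n w → DyckComplex.deg n (V w) ≡ degree w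
deg≡degree {n} {w} 1≤n dy = ℕₚ.≤-antisym (max≤v⁺ z≤n (All.tabulate below)) (v≤max⁺ 0 _ (inj₂ above))
  where
  open DyckComplex n using (_⊆?_)
  below : ∀ {m} → m ∈ map length (filter (V w ⊆?_) (ΔDyck n)) → m ≤ degree w
  below m∈ with ∈-map⁻ length m∈
  ... | τ , τ∈ , refl with ∈-filter⁻ (V w ⊆?_) {xs = ΔDyck n} τ∈
  ...   | τ∈Δ , sub with ∈-Δ⁻ {n} τ∈Δ
  ...     | w′ , dy′ , refl =
      subst (_≤ degree w) (sym (length-V w′)) (length≤degree 1≤n dy dy′ (V-⊆⁻ w w′ sub))
  above : Any (degree w ≤_) (map length (filter (V w ⊆?_) (ΔDyck n)))
  above with saturated 1≤n dy
  ... | w′ , dy′ , sub , len = lose (∈-map⁺ length (∈-filter⁺ (V w ⊆?_) (∈-Δ⁺ dy′) (V-⊆⁺ w w′ sub)))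
    (ℕₚ.≤-reflexive (trans (sym len) (sym (length-V w′))))

-- The empty chain from (0 , 0) to (n , n) has gap n, so saturating it gives a face with n - 1
-- points.
rank-bound : ∀ n → 1 ≤ n → n ∸ 1 ≤ DyckComplex.rank n
rank-bound n 1≤n with saturate {Q = n , n} {P = 0 , 0} z≤n (end (1≤n , 1≤n))
... | c , ch , _ , len with Chain⇒Dyck ch
...   | w , dy , eq = v≤max⁺ 0 _ (inj₂ (lose (∈-map⁺ length (∈-Δ⁺ dy))
  (ℕₚ.≤-reflexive (sym (trans (length-V w) (trans (cong length eq) (cong pred (trans len (ℕₚ.⊓-idem n)))))))))

⊆⇒excess≡0 : ∀ {n w w′} → 1 ≤ n → IsDyckOf n w → IsDyckOf n w′ → length (valleys w′) ≡ degree w →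
  valleys w′ ⊆ valleys w → excess (up 0) w ≡ 0
⊆⇒excess≡0 {w = w} 1≤n dy dy′ len sub with ⊆⇒≡⊎< (Dyck⇒Chain 1≤n dy′) (Dyck⇒Chain 1≤n dy) sub
... | inj₁ eq =
    ℕₚ.+-cancelʳ-≡ (length (valleys w)) (excess (up 0) w) 0 (trans (sym len) (cong length eq))
... | inj₂ lt =
    contradiction (subst (_< length (valleys w)) len lt) (ℕₚ.≤⇒≯ (ℕₚ.m≤n+m (length (valleys w)) (excess (up 0) w)))

-- A saturation has `excess` more points than the face it contains, and a maximal face contains its
-- own saturation.
Maximal⇒excess≡0 : ∀ {n w} → 1 ≤ n → IsDyckOf n w → DyckComplex.Maximal n (V w) → excess (up 0) w ≡ 0
Maximal⇒excess≡0 {n} {w} 1≤n dy mx =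
  let w′ , dy′ , sub , len = saturated 1≤n dy
  in ⊆⇒excess≡0 1≤n dy dy′ len (V-⊆⁻ w′ w (All.lookup mx (∈-Δ⁺ dy′) (V-⊆⁺ w w′ sub)))

excess≡0⇒≡ : ∀ {n w w′} → 1 ≤ n → IsDyckOf n w → IsDyckOf n w′ → excess (up 0) w ≡ 0 →
  valleys w ⊆ valleys w′ → valleys w ≡ valleys w′
excess≡0⇒≡ {w = w} 1≤n dy dy′ e sub with ⊆⇒≡⊎< (Dyck⇒Chain 1≤n dy) (Dyck⇒Chain 1≤n dy′) sub
... | inj₁ eq = eq
... | inj₂ lt = contradiction lt (ℕₚ.≤⇒≯ (ℕₚ.≤-trans (length≤degree 1≤n dy dy′ sub)
                  (ℕₚ.≤-reflexive (cong (_+ length (valleys w)) e))))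

excess≡0⇒Maximal : ∀ {n w} → 1 ≤ n → IsDyckOf n w → excess (up 0) w ≡ 0 → DyckComplex.Maximal n (V w)
excess≡0⇒Maximal {n} {w} 1≤n dy e = All.tabulate {P = λ τ → V w ⊆ τ → τ ⊆ V w} λ {τ} τ∈ →
  let w′ , dy′ , eq = ∈-Δ⁻ {n} τ∈
  in subst (λ τ → V w ⊆ τ → τ ⊆ V w) (sym eq) λ sub →
     V-⊆⁺ w′ w λ {x} → subst (x ∈_) (sym (excess≡0⇒≡ 1≤n dy dy′ e (V-⊆⁻ w w′ sub)))

-- Sums over lists and the final count

∑ˡ : ∀ {A : Set} → List A → (A → ℤ) → ℤ
∑ˡ []       φ = + 0
∑ˡ (x ∷ xs) φ = φ x ℤ.+ ∑ˡ xs φ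

∑ˡ-cong : ∀ {A : Set} xs {φ ψ : A → ℤ} → (∀ {x} → x ∈ xs → φ x ≡ ψ x) → ∑ˡ xs φ ≡ ∑ˡ xs ψ
∑ˡ-cong []       e = refl
∑ˡ-cong (x ∷ xs) e = cong₂ ℤ._+_ (e (here refl)) (∑ˡ-cong xs (e ∘ there))

∑ˡ-map : ∀ {A B : Set} (g : A → B) xs φ → ∑ˡ (map g xs) φ ≡ ∑ˡ xs (φ ∘ g)
∑ˡ-map g []       φ = refl
∑ˡ-map g (x ∷ xs) φ = +-congˡ (φ (g x)) (∑ˡ-map g xs φ)

∑ˡ-++ : ∀ {A : Set} xs ys (φ : A → ℤ) → ∑ˡ (xs ++ ys) φ ≡ ∑ˡ xs φ ℤ.+ ∑ˡ ys φ
∑ˡ-++ []       ys φ = sym (ℤₚ.+-identityˡ _)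
∑ˡ-++ (x ∷ xs) ys φ = trans (+-congˡ (φ x) (∑ˡ-++ xs ys φ)) (sym (ℤₚ.+-assoc (φ x) _ _))

∑ˡ-filter : ∀ {A : Set} {P : A → Set} (P? : Decidable P) xs φ →
  ∑ˡ (filter P? xs) φ ≡ ∑ˡ xs (λ x → φ x when does (P? x))
∑ˡ-filter P? []       φ = refl
∑ˡ-filter P? (x ∷ xs) φ with does (P? x)
... | true  = +-congˡ (φ x) (∑ˡ-filter P? xs φ)
... | false = trans (∑ˡ-filter P? xs φ) (sym (ℤₚ.+-identityˡ _))

length≡∑ˡ : ∀ {A : Set} (xs : List A) → + length xs ≡ ∑ˡ xs (λ _ → + 1)
length≡∑ˡ []       = refl
length≡∑ˡ (x ∷ xs) = trans (ℤₚ.pos-+ 1 (length xs)) (+-congˡ (+ 1) (length≡∑ˡ xs))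

count : ∀ {A : Set} {P : A → Set} (P? : Decidable P) xs →
  + length (filter P? xs) ≡ ∑ˡ xs (λ x → (+ 1) when does (P? x))
count P? xs = trans (length≡∑ˡ (filter P? xs)) (∑ˡ-filter P? xs _)

∑ˡ-words : ∀ k φ → ∑ˡ (words k) φ ≡ ∑ʷ k φ
∑ˡ-words zero    φ = ℤₚ.+-identityʳ (φ [])
∑ˡ-words (suc k) φ = trans (∑ˡ-++ (map (U ∷_) (words k)) (map (D ∷_) (words k) ++ []) φ)
  (cong₂ ℤ._+_ (part U) (trans (cong (λ ws → ∑ˡ ws φ) (++-identityʳ (map (D ∷_) (words k)))) (part D)))
  where
  part : ∀ s → ∑ˡ (map (s ∷_) (words k)) φ ≡ ∑ʷ k (λ w → φ (s ∷ w))
  part s = trans (∑ˡ-map (s ∷_) (words k) φ) (∑ˡ-words k (λ w → φ (s ∷ w)))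

∑ˡ-Dyck : ∀ n φ → ∑ˡ (Dyck n) φ ≡ ∑ʷ (2 ℕ.* n) (λ w → φ w when valid 0 w)
∑ˡ-Dyck n φ = trans (∑ˡ-filter isDyck? (words (2 ℕ.* n)) φ) (trans (∑ˡ-words (2 ℕ.* n) _)
  (∑ʷ-cong (2 ℕ.* n) λ w → cong (φ w when_) (isDyck≡valid w)))
  where
  isDyck≡valid : ∀ w → does (isDyck? w) ≡ valid 0 w
  isDyck≡valid w =
    does-true⇔ (isDyck? w) (λ (e , ps) → ⇒valid 0 w e ps) (λ v → valid⇒# 0 w v , valid⇒inits 0 w v)
    where
    does-true⇔ : ∀ {P : Set} {β} (P? : Dec P) → (P → β ≡ true) → (β ≡ true → P) → does P? ≡ β
    does-true⇔ (yes p) f g = sym (f p)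
    does-true⇔ {β = true}  (no ¬p) f g = contradiction (g refl) ¬p
    does-true⇔ {β = false} (no ¬p) f g = refl

∑-∑ˡ : ∀ {A : Set} n (xs : List A) (g : ℕ → A → ℤ) →
  ∑ n (λ k → ∑ˡ xs (g k)) ≡ ∑ˡ xs (λ x → ∑ n (λ k → g k x))
∑-∑ˡ n []       g = ∑-zero n λ _ → refl
∑-∑ˡ n (x ∷ xs) g = trans (∑-+ n (λ k → g k x) (λ k → ∑ˡ xs (g k))) (+-congˡ (∑ n (λ k → g k x)) (∑-∑ˡ n xs g))

∑ˡ-*ʳ : ∀ {A : Set} (xs : List A) φ c → ∑ˡ xs φ ℤ.* c ≡ ∑ˡ xs (λ x → φ x ℤ.* c)
∑ˡ-*ʳ []       φ c = refl
∑ˡ-*ʳ (x ∷ xs) φ c = trans (ℤₚ.*-distribʳ-+ c (φ x) (∑ˡ xs φ)) (+-congˡ (φ x ℤ.* c) (∑ˡ-*ʳ xs φ c))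

-- Picks out xⁱ⁺¹yᵏ: a nonempty Dyck path has one block more than it has valleys.
monomial : ℕ → ℕ → Functional
monomial i k a s = coefficient k s when (a ≡ᵇ suc i)

eval[y-1]^-when : ∀ e f β → eval[y-1]^ e (λ s → f s when β) ≡ eval[y-1]^ e f when β
eval[y-1]^-when e f true  = refl
eval[y-1]^-when zero    f false = refl
eval[y-1]^-when (suc e) f false = eval[y-1]^-when e f false

-- A path with v valleys and excess e has degree e + v. It contributes only to row i = e + v, and
-- there only for j′ = v, where i ∸ j′ is e.
F-weight : ∀ i k e v →
  ∑ i (λ j′ → ((+ 1) when ((v ≡ᵇ j′) ∧ (e + v ≡ᵇ i))) ℤ.* eval[y-1]^ (i ∸ j′) (coefficient k))
  ≡ eval[y-1]^ e (monomial i k (suc (e + v)))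
F-weight i k e v with e + v ≟ i
... | yes refl = trans (∑-cong (e + v) λ j′ _ → lem j′ (v ≟ j′))
    (trans (∑-single (e + v) v (λ j′ → eval[y-1]^ (e + v ∸ j′) (coefficient k)) (ℕₚ.m≤n+m v e))
      (trans (cong (λ m → eval[y-1]^ m (coefficient k)) (ℕₚ.m+n∸n≡m e v))
        (cong (λ β → eval[y-1]^ e (λ s → coefficient k s when β)) (sym (≡ᵇ-refl (e + v))))))
  where
  lem : ∀ j′ → Dec (v ≡ j′) →
    ((+ 1) when ((v ≡ᵇ j′) ∧ (e + v ≡ᵇ e + v))) ℤ.* eval[y-1]^ (e + v ∸ j′) (coefficient k)
    ≡ eval[y-1]^ (e + v ∸ j′) (coefficient k) when (j′ ≡ᵇ v)
  lem j′ (yes refl) rewrite ≡ᵇ-refl v | ≡ᵇ-refl (e + v) = ℤₚ.*-identityˡ _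
  lem j′ (no v≢j′)  rewrite ≢⇒≡ᵇ-false v≢j′ | ≢⇒≡ᵇ-false (v≢j′ ∘ sym) =
    ℤₚ.*-zeroˡ (eval[y-1]^ (e + v ∸ j′) (coefficient k))
... | no ≢i =
    trans (∑-zero i λ j′ → 0-* _ (cong ((+ 1) when_)
    (trans (cong ((v ≡ᵇ j′) ∧_) (≢⇒≡ᵇ-false ≢i)) (∧-zeroʳ (v ≡ᵇ j′)))))
  (sym (trans (cong (λ β → eval[y-1]^ e (λ s → coefficient k s when β)) (≢⇒≡ᵇ-false ≢i))
    (eval[y-1]^-when e (coefficient k) false)))

H-weight : ∀ i k e v s β → β ≡ (e ≡ᵇ 0) →
  ((+ 1) when ((v ≡ᵇ i) ∧ (s ≡ᵇ k))) when β ≡ eval0^ e (monomial i k (suc (e + v)) s)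
H-weight i k (suc e) v s _ refl = refl
H-weight i k zero    v s _ refl with v ≡ᵇ i
... | true  = refl
... | false = refl

f-sum : ∀ n → 1 ≤ n → ∀ i k →
  ∑ i (λ j′ → + DyckComplex.f n i j′ ℤ.* eval[y-1]^ (i ∸ j′) (coefficient k)) ≡ F (monomial i k) (up 0) 0 (2 ℕ.* n)
f-sum n 1≤n i k = begin
  ∑ i (λ j′ → + f i j′ ℤ.* c j′)
    ≡⟨ ∑-cong i (λ j′ _ → trans (cong (ℤ._* c j′) (f-count j′)) (∑ˡ-*ʳ (Dyck n) _ (c j′))) ⟩
  ∑ i (λ j′ → ∑ˡ (Dyck n) λ w → ((+ 1) when ((length (V w) ≡ᵇ j′) ∧ (deg (V w) ≡ᵇ i))) ℤ.* c j′)
    ≡⟨ ∑-∑ˡ i (Dyck n) _ ⟩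
  ∑ˡ (Dyck n) (λ w → ∑ i λ j′ → ((+ 1) when ((length (V w) ≡ᵇ j′) ∧ (deg (V w) ≡ᵇ i))) ℤ.* c j′)
    ≡⟨ ∑ˡ-cong (Dyck n) (λ {w} w∈ → weight w (∈-Dyck⁻ n w∈)) ⟩
  ∑ˡ (Dyck n) (λ w → eval[y-1]^ (excess (up 0) w) (monomial i k (minSum (up 0) w)))
    ≡⟨ ∑ˡ-Dyck n _ ⟩
  F (monomial i k) (up 0) 0 (2 ℕ.* n) ∎
  where
  open ≡-Reasoning
  open DyckComplex n using (f; deg)
  c : ℕ → ℤ
  c j′ = eval[y-1]^ (i ∸ j′) (coefficient k)
  f-count : ∀ j′ → + f i j′ ≡ ∑ˡ (Dyck n) (λ w → (+ 1) when ((length (V w) ≡ᵇ j′) ∧ (deg (V w) ≡ᵇ i)))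
  f-count j′ = trans (count (λ σ → (length σ ≟ j′) ×-dec (deg σ ≟ i)) (ΔDyck n))
    (trans (cong (λ Δ → ∑ˡ Δ (λ σ → (+ 1) when ((length σ ≡ᵇ j′) ∧ (deg σ ≡ᵇ i)))) (ΔDyck≡ n))
      (∑ˡ-map V (Dyck n) _))
  weight : ∀ w → IsDyckOf n w →
    ∑ i (λ j′ → ((+ 1) when ((length (V w) ≡ᵇ j′) ∧ (deg (V w) ≡ᵇ i))) ℤ.* c j′)
    ≡ eval[y-1]^ (excess (up 0) w) (monomial i k (minSum (up 0) w))
  weight w dy = trans
    (∑-cong i λ j′ _ → cong₂ (λ v m → ((+ 1) when ((v ≡ᵇ j′) ∧ (m ≡ᵇ i))) ℤ.* c j′) (length-V w) (deg≡degree 1≤n dy))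
    (trans (F-weight i k (excess (up 0) w) (length (valleys w)))
      (cong (λ m → eval[y-1]^ (excess (up 0) w) (monomial i k m)) (sym (Dyck-minSum 1≤n dy))))

maximal-count : ∀ n → 1 ≤ n → ∀ i k →
  + length (filter (λ w → (length (V w) ≟ i) ×-dec (sucᵛ w ≟ k)) (Dyckᵐᵃˣ n)) ≡ H (monomial i k) (up 0) 0 (2 ℕ.* n)
maximal-count n 1≤n i k = begin
  + length (filter (λ w → (length (V w) ≟ i) ×-dec (sucᵛ w ≟ k)) (Dyckᵐᵃˣ n))
    ≡⟨ count (λ w → (length (V w) ≟ i) ×-dec (sucᵛ w ≟ k)) (Dyckᵐᵃˣ n) ⟩
  ∑ˡ (Dyckᵐᵃˣ n) (λ w → (+ 1) when ((length (V w) ≡ᵇ i) ∧ (sucᵛ w ≡ᵇ k)))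
    ≡⟨ ∑ˡ-filter (λ w → maximal? (V w)) (Dyck n) _ ⟩
  ∑ˡ (Dyck n) (λ w → ((+ 1) when ((length (V w) ≡ᵇ i) ∧ (sucᵛ w ≡ᵇ k))) when does (maximal? (V w)))
    ≡⟨ ∑ˡ-cong (Dyck n) (λ {w} w∈ → weight w (∈-Dyck⁻ n w∈)) ⟩
  ∑ˡ (Dyck n) (λ w → eval0^ (excess (up 0) w) (monomial i k (minSum (up 0) w) (singles (up 0) w)))
    ≡⟨ ∑ˡ-Dyck n _ ⟩
  H (monomial i k) (up 0) 0 (2 ℕ.* n) ∎
  where
  open ≡-Reasoning
  open DyckComplex n using (maximal?)
  weight : ∀ w → IsDyckOf n w →
    ((+ 1) when ((length (V w) ≡ᵇ i) ∧ (sucᵛ w ≡ᵇ k))) when does (maximal? (V w))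
    ≡ eval0^ (excess (up 0) w) (monomial i k (minSum (up 0) w) (singles (up 0) w))
  weight w dy = trans
    (cong₂ (λ v s → ((+ 1) when ((v ≡ᵇ i) ∧ (s ≡ᵇ k))) when does (maximal? (V w))) (length-V w) (sucᵛ≡singles 1≤n dy))
    (trans (H-weight i k (excess (up 0) w) (length (valleys w)) (singles (up 0) w) (does (maximal? (V w)))
             (does-⇔ (mk⇔ (Maximal⇒excess≡0 1≤n dy) (excess≡0⇒Maximal 1≤n dy))
                (maximal? (V w)) (excess (up 0) w ≟ 0)))
      (cong (λ m → eval0^ (excess (up 0) w) (monomial i k m (singles (up 0) w))) (sym (Dyck-minSum 1≤n dy))))

F≡H : ∀ n → 1 ≤ n → ∀ ψ → F ψ (up 0) 0 (2 ℕ.* n) ≡ H ψ (up 0) 0 (2 ℕ.* n)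
-- A Dyck path cannot start with D, so that branch vanishes on both sides; the length is what 2(n +
-- 1) leaves after the first U.
F≡H (suc n) _ ψ = cong (ℤ._+ ∑ʷ (n + suc (n + 0)) (λ _ → + 0)) (F≡H-up (n + suc (n + 0)) ψ 0)

theorem3p10 : ∀ (n : ℕ) → 1 ≤ n →
    ∀ (h : ℕ → ℕ → ℤ) → DyckComplex.IsHTriangle n h →
    ∀ (i j : ℕ) → j ≤ i → i ≤ n ∸ 1 →
    h i j ≡ + length (filter (λ w → (length (V w) ≟ i) ×-dec (sucᵛ w ≟ i ∸ j)) (Dyckᵐᵃˣ n))
theorem3p10 n 1≤n h isH i j j≤i i≤n-1 = begin
  h i j
    ≡⟨ h-formula _≟ᵖ_ (ΔDyck n) h isH i j j≤i (ℕₚ.≤-trans i≤n-1 (rank-bound n 1≤n)) ⟩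
  ∑ i (λ j′ → + DyckComplex.f n i j′ ℤ.* eval[y-1]^ (i ∸ j′) (coefficient (i ∸ j)))
    ≡⟨ f-sum n 1≤n i (i ∸ j) ⟩
  F (monomial i (i ∸ j)) (up 0) 0 (2 ℕ.* n)
    ≡⟨ F≡H n 1≤n (monomial i (i ∸ j)) ⟩
  H (monomial i (i ∸ j)) (up 0) 0 (2 ℕ.* n)
    ≡⟨ maximal-count n 1≤n i (i ∸ j) ⟨
  + length (filter (λ w → (length (V w) ≟ i) ×-dec (sucᵛ w ≟ i ∸ j)) (Dyckᵐᵃˣ n)) ∎
  where open ≡-Reasoning
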